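{- Let $0<1/n\ll 1/\ell\ll\varepsilon\ll\gamma\ll 1/r$ where $n,\ell,r\in\mathbb N$ and $r\ge 3$. Suppose that $G$ is a digraph on $n$ vertices such that for every $x\in V(G)$, $d^+(x)\ge (1-1/r-\varepsilon)n$ or $d^-(x)\ge (1-1/r-\varepsilon)n$. Further suppose that for any $x,y\in V(G)$, if $d^+(x)<(1-1/r-\varepsilon)n$ and $d^-(y)<(1-1/r-\varepsilon)n$ then $xy\notin E(G)$. Then at least one of the following holds: (i) $G$ contains a $T_r$-packing that covers all but at most $\ell$ vertices; (ii) $G$ contains a $\gamma$-independent set of size at least $n/r$.
   Context: Hierarchy notation: $0<a\ll b\ll c$ means the constants are chosen from right to left, each sufficiently small in terms of those to its right (there are increasing functions $f,g$ such that the statement holds whenever $b\le f(c)$ and $a\le g(b)$); longer hierarchies are analogous. A digraph has no loops and at most one edge in each direction between any two vertices; $xy$ denotes the edge from $x$ to $y$; $d^\pm(x)$ are out-/indegree. $T_r$ is the transitive tournament on $r$ vertices. A $T_r$-packing is a collection of vertex-disjoint (not necessarily induced) copies of $T_r$. For $G$ on $n$ vertices, $S\subseteq V(G)$ is $\gamma$-independent if $G[S]$ has at most $\gamma n^2$ edges. -}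

module Defs where

open import Data.Nat as ℕ using (ℕ; zero; suc; _≤_; _<_)
open import Data.Fin using (Fin; zero; suc)
open import Data.Bool using (Bool; true; false; _∧_; not)
open import Data.Integer using (+_)
open import Data.Rational using (ℚ; _/_; 0ℚ; 1ℚ; _-_; _*_)
open import Data.Product using (Σ; ∃; _×_; _,_)
open import Data.Empty using (⊥)
open import Relation.Binary.PropositionalEquality using (_≡_)
open import Function.Definitions using (Injective)

ℕtoℚ : ℕ → ℚ
ℕtoℚ k = + k / 1

-- 1/k as a rational (only used for k = r ≥ 3; the value at 0 is irrelevant).
inv : ℕ → ℚ
inv zero    = 0ℚ
inv (suc k) = + 1 / suc k

sumFin : ∀ {n} → (Fin n → ℕ) → ℕ
sumFin {zero}  f = 0
sumFin {suc n} f = f zero ℕ.+ sumFin (λ i → f (suc i))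

boolToℕ : Bool → ℕ
boolToℕ true  = 1
boolToℕ false = 0

count : ∀ {n} → (Fin n → Bool) → ℕ
count f = sumFin (λ i → boolToℕ (f i))

-- A digraph on vertex set Fin n: adjacency adj x y = true iff xy is an edge.
-- No loops; a relation automatically has at most one edge in each direction.
record Digraph (n : ℕ) : Set where
  field
    adj      : Fin n → Fin n → Bool
    loopless : ∀ x → adj x x ≡ false
open Digraph public

outdeg : ∀ {n} → Digraph n → Fin n → ℕ
outdeg G x = count (λ y → adj G x y)

indeg : ∀ {n} → Digraph n → Fin n → ℕ
indeg G y = count (λ x → adj G x y)

VSet : ℕ → Set
VSet n = Fin n → Bool

edgesIn : ∀ {n} → Digraph n → VSet n → ℕ
edgesIn G S = sumFin (λ x → count (λ y → S x ∧ S y ∧ adj G x y))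

γIndependent : ∀ {n} → Digraph n → ℚ → VSet n → Set
γIndependent {n} G γ S = ℕtoℚ (edgesIn G S) Data.Rational.≤ γ * ℕtoℚ (n ℕ.* n)

-- A copy of T_r in G: an injective map Fin r → V(G) such that
-- f i f j is an edge whenever i < j (transitive tournament ordering).
TrCopy : ∀ {n} → Digraph n → (r : ℕ) → (Fin r → Fin n) → Set
TrCopy G r f = Injective _≡_ _≡_ f × (∀ i j → i Data.Fin.< j → adj G (f i) (f j) ≡ true)

record TrPacking {n} (G : Digraph n) (r : ℕ) : Set where
  field
    k        : ℕ
    copy     : Fin k → Fin r → Fin n
    isCopy   : ∀ c → TrCopy G r (copy c)
    disjoint : ∀ c c' i i' → copy c i ≡ copy c' i' → c ≡ c'
open TrPacking public

Covered : ∀ {n} {G : Digraph n} {r} → TrPacking G r → Fin n → Set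
Covered P x = Σ (Fin (k P)) λ c → Σ _ λ i → copy P c i ≡ x

CoversAllBut : ∀ {n} {G : Digraph n} {r} → TrPacking G r → ℕ → Set
CoversAllBut {n} P ℓ = Σ (VSet n) λ U → count U ≤ ℓ × (∀ x → U x ≡ false → Covered P x)

{-# OPTIONS --safe #-}

-- Let every vertex use one of its two neighbourhoods, an out- or an inneighbourhood that is
-- large; it "sees" the vertices in it.  A set that can be listed so that each vertex sees all
-- later ones spans a transitive tournament, and if X and R are such sets and X sees R, then
-- X ∪ R is one.  Partition the vertices into such sets (pieces) of size at most r, with the
-- sum of the squares of the sizes as large as possible, and let s be the largest size below
-- r that occurs more than r times (if there is none, few vertices lie outside the T_r's).
-- No rearrangement of pieces can replace sizes t ≤ s by t − 1 and s + 1.  Together with the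
-- degree condition this forces, for any r + 1 pieces X of size s and all but few of the
-- pieces Y of size r, that each x ∈ X misses (does not see) exactly one vertex of Y, that
-- x ↦ this vertex is injective, and that the set of missed vertices does not depend on X.
-- Now fix x ∈ X.  Suppose x misses y ∈ Y and w ∈ Y′ and y sees w.  Exchange x for y and then
-- add w to X; the place of w in Y′ is taken by an element of another piece of size s that
-- misses it too: a contradiction.  The missed vertices are about n / r many, and the argument
-- applies to both neighbourhoods of y if both are large; an edge yw for which neither the
-- outneighbourhood of y nor the inneighbourhood of w is large does not exist by assumption.
-- So they are independent in G.
module Submission where

open import Defs
open import Data.Nat using (ℕ; _≤_)
open import Data.Fin using (Fin)
open import Data.Bool using (true)
open import Data.Product using (Σ; _×_; _,_)
open import Data.Sum using (_⊎_)
open import Relation.Binary.PropositionalEquality using (_≡_)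
open import Data.Empty using (⊥)

open import Data.Bool.Base using (Bool; false; if_then_else_; not; _∧_; _∨_)
import Data.Bool.Properties as Bool
open import Data.Empty using (⊥-elim)
open import Data.Fin.Base as Fin using (zero; suc; toℕ; fromℕ<)
import Data.Fin.Properties as Fin
open import Data.Integer.Base as ℤ using (+[1+_]; -[1+_]; +0)
import Data.Integer.Properties as ℤ
import Data.Integer.Solver as ℤ
open import Data.List.Base using (List; []; _∷_; _++_; map; length; lookup; tabulate; allFin; [_])
open import Data.List.Membership.Propositional using (_∈_; find)
open import Data.List.Membership.Propositional.Properties using (∈-∃++; ∈-++⁺ˡ; ∈-++⁻; ∈-lookup; ∈-map⁺; ∈-map⁻)
open import Data.List.Properties using (map-++; length-++; length-map)
open import Data.List.Relation.Binary.Permutation.Propositional as Perm using (_↭_; prep; ↭-refl; ↭-sym; ↭-trans)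
open import Data.List.Relation.Binary.Permutation.Propositional.Properties using (map⁺; shift; ↭-length; ∈-resp-↭; All-resp-↭; ++-comm; drop-∷) renaming (++⁺ to ↭-++⁺)
open import Data.List.Relation.Unary.All as All using (All; []; _∷_)
import Data.List.Relation.Unary.All.Properties as All
open import Data.List.Relation.Unary.AllPairs using (AllPairs; []; _∷_)
import Data.List.Relation.Unary.AllPairs.Properties as AllPairs
open import Data.List.Relation.Unary.Any as Any using (here; there)
open import Data.List.Relation.Unary.Any.Properties using (lookup-index)
open import Data.Nat.Base as ℕ using (zero; suc; _+_; _∸_; z≤n; s≤s)
open import Data.Nat.ListAction using (sum)
open import Data.Nat.ListAction.Properties using (sum-++; sum-↭)
open import Data.Nat.Properties
open import Data.Nat.Solver using (module +-*-Solver)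
open import Data.Product using (∃; ∃₂; proj₁; proj₂)
open import Data.Rational.Base as ℚ using (mkℚ; toℚᵘ; fromℚᵘ)
import Data.Rational.Properties as ℚ
import Data.Rational.Solver as ℚ
open import Data.Rational.Unnormalised.Base as ℚᵘ using (ℚᵘ; mkℚᵘ; *≡*; *≤*)
import Data.Rational.Unnormalised.Properties as ℚᵘ
open import Data.Sum.Base using (inj₁; inj₂)
open import Function.Base using (_∘_; id)
open import Relation.Binary.Definitions using (tri<; tri≈; tri>)
open import Relation.Binary.PropositionalEquality using (_≢_; refl; sym; trans; cong; cong₂; subst; subst₂; module ≡-Reasoning)
open import Relation.Nullary using (¬_; Dec; yes; no; does)
open import Relation.Nullary.Decidable using (map′; dec-true; dec-false; decidable-stable; _×-dec_; _⊎-dec_; _→-dec_)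

module Combinatorics where

  open Data.Nat using (_*_)

  -- Sums over lists and indicators.

  private variable B C : Set

  ∑ : (B → ℕ) → List B → ℕ
  ∑ f xs = sum (map f xs)

  ∑-++ : ∀ (f : B → ℕ) xs ys → ∑ f (xs ++ ys) ≡ ∑ f xs + ∑ f ys
  ∑-++ f xs ys = trans (cong sum (map-++ f xs ys)) (sum-++ (map f xs) (map f ys))

  ∑-↭ : ∀ (f : B → ℕ) {xs ys} → xs ↭ ys → ∑ f xs ≡ ∑ f ys
  ∑-↭ f p = sum-↭ (map⁺ f p)

  ∑-mono : ∀ {f g : B → ℕ} xs → (∀ {x} → x ∈ xs → f x ≤ g x) → ∑ f xs ≤ ∑ g xs
  ∑-mono []       h = z≤n
  ∑-mono (x ∷ xs) h = +-mono-≤ (h (here refl)) (∑-mono xs (h ∘ there))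

  ∑-cong : ∀ {f g : B → ℕ} xs → (∀ {x} → x ∈ xs → f x ≡ g x) → ∑ f xs ≡ ∑ g xs
  ∑-cong []       h = refl
  ∑-cong (x ∷ xs) h = cong₂ _+_ (h (here refl)) (∑-cong xs (h ∘ there))

  interchange : ∀ a b c d → (a + b) + (c + d) ≡ (a + c) + (b + d)
  interchange = solve 4 (λ a b c d → (a :+ b) :+ (c :+ d) := (a :+ c) :+ (b :+ d)) refl
    where open +-*-Solver

  ∑-+ : ∀ (f g : B → ℕ) xs → ∑ (λ x → f x + g x) xs ≡ ∑ f xs + ∑ g xs
  ∑-+ f g []       = refl
  ∑-+ f g (x ∷ xs) = trans (cong (f x + g x +_) (∑-+ f g xs)) (interchange (f x) (g x) _ _)

  ∑-* : ∀ k (f : B → ℕ) xs → ∑ (λ x → k * f x) xs ≡ k * ∑ f xs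
  ∑-* k f []       = sym (*-zeroʳ k)
  ∑-* k f (x ∷ xs) = trans (cong (k * f x +_) (∑-* k f xs)) (sym (*-distribˡ-+ k (f x) _))

  ∑-const : ∀ k (xs : List B) → ∑ (λ _ → k) xs ≡ length xs * k
  ∑-const k []       = refl
  ∑-const k (x ∷ xs) = cong (k +_) (∑-const k xs)

  ∑-≥ : ∀ {f : B → ℕ} k xs → (∀ {x} → x ∈ xs → k ≤ f x) → length xs * k ≤ ∑ f xs
  ∑-≥ k xs h = subst (_≤ _) (∑-const k xs) (∑-mono xs h)

  ∑-≤ : ∀ {f : B → ℕ} k xs → (∀ {x} → x ∈ xs → f x ≤ k) → ∑ f xs ≤ length xs * k
  ∑-≤ k xs h = subst (_ ≤_) (∑-const k xs) (∑-mono xs h)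

  ∑-swap : ∀ (f : B → C → ℕ) xs ys → ∑ (λ x → ∑ (f x) ys) xs ≡ ∑ (λ y → ∑ (λ x → f x y) xs) ys
  ∑-swap f []       ys = sym (trans (∑-const 0 ys) (*-zeroʳ (length ys)))
  ∑-swap f (x ∷ xs) ys = trans (cong (∑ (f x) ys +_) (∑-swap f xs ys)) (sym (∑-+ (f x) _ ys))

  ∑-∈ : ∀ (f : B → ℕ) {x xs} → x ∈ xs → f x ≤ ∑ f xs
  ∑-∈ f (here refl) = m≤m+n _ _
  ∑-∈ f (there x∈) = ≤-trans (∑-∈ f x∈) (m≤n+m _ _)

  ∑<length⇒∃zero : ∀ (f : B → ℕ) xs → ∑ f xs ℕ.< length xs → ∃ λ x → x ∈ xs × f x ≡ 0
  ∑<length⇒∃zero f (x ∷ xs) lt with f x in eq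
  ... | zero  = x , here refl , eq
  ... | suc k with ∑<length⇒∃zero f xs (≤-trans (s≤s (m≤n+m _ k)) (ℕ.s≤s⁻¹ lt))
  ...   | y , y∈ , fy = y , there y∈ , fy

  ∑≢0⇒∃ : ∀ (f : B → ℕ) xs → ∑ f xs ≢ 0 → ∃ λ x → x ∈ xs × f x ≢ 0
  ∑≢0⇒∃ f []       h = ⊥-elim (h refl)
  ∑≢0⇒∃ f (x ∷ xs) h with f x ≟ 0
  ... | no  fx≢0 = x , here refl , fx≢0
  ... | yes fx≡0 with ∑≢0⇒∃ f xs (λ eq → h (cong₂ _+_ fx≡0 eq))
  ...   | y , y∈ , fy≢0 = y , there y∈ , fy≢0

  ∑≡0⇒≡0 : ∀ (f : B → ℕ) {x xs} → x ∈ xs → ∑ f xs ≡ 0 → f x ≡ 0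
  ∑≡0⇒≡0 f x∈ eq = n≤0⇒n≡0 (subst (f _ ≤_) eq (∑-∈ f x∈))

  ∑≡length⇒≡1 : ∀ (f : B → ℕ) xs → (∀ {x} → x ∈ xs → 1 ≤ f x) → ∑ f xs ≡ length xs → ∀ {x} → x ∈ xs → f x ≡ 1
  ∑≡length⇒≡1 f (y ∷ xs) pos eq = go
    where
    tail≥ : length xs ≤ ∑ f xs
    tail≥ = subst (_≤ ∑ f xs) (*-identityʳ _) (∑-≥ 1 xs (pos ∘ there))
    head≡ : f y ≡ 1
    head≡ = ≤-antisym (+-cancelʳ-≤ (∑ f xs) (f y) 1 (≤-trans (≤-reflexive eq) (s≤s tail≥))) (pos (here refl))
    go : ∀ {x} → x ∈ (y ∷ xs) → f x ≡ 1
    go (here refl) = head≡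
    go (there x∈)  = ∑≡length⇒≡1 f xs (pos ∘ there) (suc-injective (trans (cong (_+ ∑ f xs) (sym head≡)) eq)) x∈

  ∑≡1⇒unique : ∀ (f : B → ℕ) xs → ∑ f xs ≡ 1 → ∀ {x y} → x ∈ xs → y ∈ xs → f x ≡ 1 → f y ≡ 1 → x ≡ y
  ∑≡1⇒unique f (z ∷ xs) eq (here refl) (here refl) _ _ = refl
  ∑≡1⇒unique f (z ∷ xs) eq (here refl) (there y∈) fz fy =
    ⊥-elim (1+n≢0 (trans (sym fy) (∑≡0⇒≡0 f y∈ (suc-injective (trans (cong (_+ ∑ f xs) (sym fz)) eq)))))
  ∑≡1⇒unique f (z ∷ xs) eq (there x∈) (here refl) fx fz =
    ⊥-elim (1+n≢0 (trans (sym fx) (∑≡0⇒≡0 f x∈ (suc-injective (trans (cong (_+ ∑ f xs) (sym fz)) eq)))))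
  ∑≡1⇒unique f (z ∷ xs) eq (there x∈) (there y∈) fx fy = ∑≡1⇒unique f xs tail≡1 x∈ y∈ fx fy
    where
    tail≡1 : ∑ f xs ≡ 1
    tail≡1 = ≤-antisym (≤-trans (m≤n+m _ (f z)) (≤-reflexive eq)) (subst (_≤ ∑ f xs) fx (∑-∈ f x∈))

  ∈⇒↭ : ∀ {x : B} {xs} → x ∈ xs → ∃ λ ys → xs ↭ x ∷ ys
  ∈⇒↭ {x = x} x∈ with ∈-∃++ x∈
  ... | ys , zs , refl = ys ++ zs , shift x ys zs

  𝟙 : {P : Set} → Dec P → ℕ
  𝟙 p? = if does p? then 1 else 0

  𝟙-yes : {P : Set} (p? : Dec P) → P → 𝟙 p? ≡ 1
  𝟙-yes p? p = cong (if_then 1 else 0) (dec-true p? p)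

  𝟙-no : {P : Set} (p? : Dec P) → ¬ P → 𝟙 p? ≡ 0
  𝟙-no p? ¬p = cong (if_then 1 else 0) (dec-false p? ¬p)

  𝟙-≤ : {P : Set} (p? : Dec P) {k : ℕ} → (P → 1 ≤ k) → 𝟙 p? ≤ k
  𝟙-≤ (yes p) h = h p
  𝟙-≤ (no ¬p) h = z≤n

  extract : ∀ {P : B → Set} (P? : ∀ x → Dec (P x)) k xs → k ≤ ∑ (𝟙 ∘ P?) xs →
            ∃₂ λ ys zs → xs ↭ ys ++ zs × length ys ≡ k × All P ys
  extract P? zero    xs       _ = [] , xs , ↭-refl , refl , []
  extract P? (suc k) (x ∷ xs) h with P? x
  ... | yes px with extract P? k xs (ℕ.s≤s⁻¹ h)
  ...   | ys , zs , p , len , all = x ∷ ys , zs , prep x p , cong suc len , px ∷ all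
  extract P? (suc k) (x ∷ xs) h | no _ with extract P? (suc k) xs h
  ...   | ys , zs , p , len , all = ys , x ∷ zs , ↭-trans (prep x p) (↭-sym (shift x ys zs)) , len , all

  separate : ∀ {P : B → Set} (P? : ∀ x → Dec (P x)) xs → ∃₂ λ ys zs → xs ↭ ys ++ zs × All P ys × All (¬_ ∘ P) zs
  separate P? [] = [] , [] , ↭-refl , [] , []
  separate P? (x ∷ xs) with P? x | separate P? xs
  ... | yes px | ys , zs , p , all , none = x ∷ ys , zs , prep x p , px ∷ all , none
  ... | no ¬px | ys , zs , p , all , none = ys , x ∷ zs , ↭-trans (prep x p) (↭-sym (shift x ys zs)) , all ,
      ¬px ∷ none

  -- Phrased for positions and not for entries, so that two equal pieces in different places are
  -- excluded as well; this makes the copies of a packing disjoint.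
  ∑≤1⇒≡ : ∀ (f : B → ℕ) xs → ∑ f xs ≤ 1 → ∀ c d → 1 ≤ f (lookup xs c) → 1 ≤ f (lookup xs d) → c ≡ d
  ∑≤1⇒≡ f (x ∷ xs) h zero    zero    _  _  = refl
  ∑≤1⇒≡ f (x ∷ xs) h zero    (suc d) fc fd = ⊥-elim
      (<⇒≱ (+-mono-≤ fc (≤-trans fd (∑-∈ f (∈-lookup {xs = xs} d)))) h)
  ∑≤1⇒≡ f (x ∷ xs) h (suc c) zero    fc fd = ⊥-elim
      (<⇒≱ (+-mono-≤ fd (≤-trans fc (∑-∈ f (∈-lookup {xs = xs} c)))) h)
  ∑≤1⇒≡ f (x ∷ xs) h (suc c) (suc d) fc fd = cong suc (∑≤1⇒≡ f xs (≤-trans (m≤n+m _ (f x)) h) c d fc fd)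

  -- Squares of lengths are what the potential adds up: taking an element from a
  -- part and giving it to another part that is at least as large increases it.
  spread : ∀ s t k → t ℕ.< s → s * s + (suc t * suc t + k) ℕ.< suc s * suc s + (t * t + k)
  spread s t k t<s with m≤n⇒∃[o]m+o≡n t<s
  ... | d , refl = subst (suc (s * s + (suc t * suc t + k)) ≤_) (identity t d k) (m≤m+n _ (1 + 2 * d))
    where
    open +-*-Solver
    identity : ∀ t d k → let s = suc t + d in
               suc (s * s + (suc t * suc t + k)) + (1 + 2 * d) ≡ suc s * suc s + (t * t + k)
    identity = solve 3 (λ t d k → let s = con 1 :+ t :+ d ; u = con 1 :+ t in
      (con 1 :+ (s :* s :+ (u :* u :+ k))) :+ (con 1 :+ con 2 :* d) := (con 1 :+ s) :* (con 1 :+ s) :+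
          (t :* t :+ k)) refl

  -- `spread` beside a full piece, with the summands in the order in which `move-A` and `move-B`
  -- list the pieces.
  spread₃ : ∀ s t r → t ℕ.< s → s * s + (suc t * suc t + (r * r + 0)) ℕ.< suc s * suc s + (r * r + (t * t + 0))
  spread₃ s t r t<s = subst (s * s + (suc t * suc t + (r * r + 0)) ℕ.<_)
      (solve 3 (λ a b c → a :+ (b :+ (c :+ con 0)) := a :+ (c :+ (b :+ con 0))) refl (suc s * suc s) (t * t)
      (r * r))
    (spread s t (r * r + 0) t<s)
    where open +-*-Solver

  spread₄ : ∀ s t r → t ℕ.< s → s * s + (suc t * suc t + (r * r + (r * r + 0))) ℕ.< suc s * suc s +
      (r * r + (r * r + (t * t + 0)))
  spread₄ s t r t<s = subst (s * s + (suc t * suc t + (r * r + (r * r + 0))) ℕ.<_)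
      (solve 3 (λ a b c → a :+ (b :+ (c :+ (c :+ con 0))) := a :+ (c :+ (c :+ (b :+ con 0)))) refl
      (suc s * suc s) (t * t) (r * r))
    (spread s t (r * r + (r * r + 0)) t<s)
    where open +-*-Solver

  -- The extreme case is s = r - 1, where (r + 1)(r - 1) + 1 = r². This is why r + 1 pieces of size
  -- s are taken: r of them that miss a full piece everywhere outweigh one that misses it rarely.
  product-bound : ∀ {s r} → s ℕ.< r → suc (suc r * s) ≤ r * r
  product-bound {s} {suc r} s<r = begin
    suc (suc (suc r) * s)   ≤⟨ s≤s (*-monoʳ-≤ (suc (suc r)) (ℕ.s≤s⁻¹ s<r)) ⟩
    suc (suc (suc r) * r)   ≡⟨ solve 1 (λ r → con 1 :+ (con 2 :+ r) :* r := (con 1 :+ r) :* (con 1 :+ r)) refl r ⟩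
    suc r * suc r           ∎
    where
    open ≤-Reasoning
    open +-*-Solver

  -- For a piece of size l ≤ s: each of the r + 1 chosen pieces misses it at least l times, and s +
  -- 1 ≤ r leaves a surplus of at least l.
  small-bound : ∀ {s r} l → s ℕ.< r → suc r * s * l + l ≤ r * (suc r * l)
  small-bound {s} {r} l s<r = begin
    suc r * s * l + l              ≤⟨ +-monoʳ-≤ (suc r * s * l) (m≤m+n l (r * l)) ⟩
    suc r * s * l + suc r * l
      ≡⟨ solve 3 (λ m s l → m :* s :* l :+ m :* l := (con 1 :+ s) :* (m :* l)) refl (suc r) s l ⟩
    suc s * (suc r * l)            ≤⟨ *-monoˡ-≤ (suc r * l) s<r ⟩
    r * (suc r * l)                ∎
    where
    open ≤-Reasoning
    open +-*-Solver

  -- Tilings of maximal potential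

  module Tiling {A V : Set} (vert : A → V) (sees : A → V → Bool) (r : ℕ) where

    _▷_ : A → A → Set
    x ▷ y = sees x (vert y) ≡ true

    -- Up to the order of its elements: each one sees all the later ones.
    Good : List A → Set
    Good X = ∃ λ X′ → X′ ↭ X × AllPairs _▷_ X′

    good-[_] : ∀ x → Good [ x ]
    good-[ x ] = [ x ] , ↭-refl , [] ∷ []

    good-↭ : ∀ {X Y} → X ↭ Y → Good X → Good Y
    good-↭ p (X′ , q , ap) = X′ , ↭-trans q p , ap

    private
      delete : ∀ {x} (ys : List A) {zs} → AllPairs _▷_ (ys ++ x ∷ zs) → AllPairs _▷_ (ys ++ zs)
      delete []       (_ ∷ ap)  = ap
      delete (y ∷ ys) (py ∷ ap) with All.++⁻ ys py
      ... | p , (_ ∷ q) = All.++⁺ p q ∷ delete ys ap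

    good-tail : ∀ {x X} → Good (x ∷ X) → Good X
    good-tail {x} (X′ , p , ap) with ∈-∃++ (∈-resp-↭ (↭-sym p) (here refl))
    ... | ys , zs , refl = ys ++ zs , drop-∷ (↭-trans (↭-sym (shift x ys zs)) p) , delete ys ap

    good-++ʳ : ∀ X {Y} → Good (X ++ Y) → Good Y
    good-++ʳ []      g = g
    good-++ʳ (x ∷ X) g = good-++ʳ X (good-tail g)

    good-++ : ∀ {X Y} → (∀ {x y} → x ∈ X → y ∈ Y → x ▷ y) → Good X → Good Y → Good (X ++ Y)
    good-++ h (X′ , p , ap) (Y′ , q , aq) = X′ ++ Y′ , ↭-++⁺ p q ,
      AllPairs.++⁺ ap aq (All.tabulate λ x∈ → All.tabulate λ y∈ → h (∈-resp-↭ p x∈) (∈-resp-↭ q y∈))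

    miss : A → A → ℕ
    miss x y = if sees x (vert y) then 0 else 1

    missedBy : List A → A → ℕ
    missedBy X y = ∑ (λ x → miss x y) X

    -- The number of pairs of x ∈ X and y ∈ Y such that x does not see y.
    μ : List A → List A → ℕ
    μ X Y = ∑ (missedBy X) Y

    miss≡0⇒▷ : ∀ x y → miss x y ≡ 0 → x ▷ y
    miss≡0⇒▷ x y eq with sees x (vert y)
    ... | true = refl

    miss≤1 : ∀ x y → miss x y ≤ 1
    miss≤1 x y with sees x (vert y)
    ... | true  = z≤n
    ... | false = ≤-refl

    missedBy≡0⇒▷ : ∀ {X x y} → missedBy X y ≡ 0 → x ∈ X → x ▷ y
    missedBy≡0⇒▷ {y = y} eq x∈ = miss≡0⇒▷ _ y (∑≡0⇒≡0 (λ x → miss x y) x∈ eq)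

    Piece : List A → Set
    Piece X = Good X × length X ≤ r

    -- The multiset of vertices of a tiling is encoded by its totals for all weights f. That a
    -- rearrangement keeps the vertices then becomes a ring identity.
    total : (V → ℕ) → List (List A) → ℕ
    total f = ∑ (∑ (f ∘ vert))

    Φ : List (List A) → ℕ
    Φ = ∑ (λ X → length X * length X)

    Φ₃ : ∀ X Y Z {a b c} → length X ≡ a → length Y ≡ b → length Z ≡ c →
         Φ (X ∷ Y ∷ Z ∷ []) ≡ a * a + (b * b + (c * c + 0))
    Φ₃ _ _ _ refl refl refl = refl

    Φ₄ : ∀ W X Y Z {a b c d} → length W ≡ a → length X ≡ b → length Y ≡ c → length Z ≡ d →
         Φ (W ∷ X ∷ Y ∷ Z ∷ []) ≡ a * a + (b * b + (c * c + (d * d + 0)))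
    Φ₄ _ _ _ _ refl refl refl refl = refl

    -- Competitors need the same vertices, but not the same elements: a vertex may be used there
    -- with its other neighbourhood, as happens in `move-C`.
    record Optimal (cs : List (List A)) : Set where
      field
        pieces : All Piece cs
        max    : ∀ {cs′} → All Piece cs′ → (∀ f → total f cs′ ≡ total f cs) → Φ cs′ ≤ Φ cs

    piece-↭ : ∀ {X Y} → X ↭ Y → Piece X → Piece Y
    piece-↭ p (g , l) = good-↭ p g , subst (_≤ r) (↭-length p) l

    piece-++ʳ : ∀ X {Y} → Piece (X ++ Y) → Piece Y
    piece-++ʳ X {Y} (g , l) = good-++ʳ X g , ≤-trans
        (≤-trans (m≤n+m _ (length X)) (≤-reflexive (sym (length-++ X)))) l

    private variable
      X Y Z X° Y° X₁ X₁° Y₁ Y₁° Q R : List A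
      x y z x₁ y₁ w a : A
      cs cs′ rest : List (List A)

    module _ (opt : Optimal cs) where
      open Optimal opt

      -- Putting `new` in the place of `old` would give a competitor of larger potential, against
      -- `max`.
      exchange : ∀ old {new} → cs ↭ old ++ rest → All Piece new →
                 (∀ f → total f new ≡ total f old) → Φ old ℕ.< Φ new → ⊥
      exchange {rest = rest} old {new} p pn same Φ< = <⇒≱ better
          (max (All.++⁺ pn (All.++⁻ʳ old (All-resp-↭ p pieces))) same′)
        where
        same′ : ∀ f → total f (new ++ rest) ≡ total f cs
        same′ f = begin
          total f (new ++ rest)         ≡⟨ ∑-++ (∑ (f ∘ vert)) new rest ⟩
          total f new + total f rest    ≡⟨ cong (_+ total f rest) (same f) ⟩
          total f old + total f rest    ≡⟨ ∑-++ (∑ (f ∘ vert)) old rest ⟨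
          total f (old ++ rest)         ≡⟨ ∑-↭ (∑ (f ∘ vert)) p ⟨
          total f cs                    ∎
          where open ≡-Reasoning
        better : Φ cs ℕ.< Φ (new ++ rest)
        better = begin-strict
          Φ cs             ≡⟨ ∑-↭ _ p ⟩
          Φ (old ++ rest)  ≡⟨ ∑-++ _ old rest ⟩
          Φ old + Φ rest   <⟨ +-monoˡ-< (Φ rest) Φ< ⟩
          Φ new + Φ rest   ≡⟨ ∑-++ _ new rest ⟨
          Φ (new ++ rest)  ∎
          where open ≤-Reasoning

      lookupPiece : X ∈ cs → Piece X
      lookupPiece = All.lookup pieces

      pieceOf : ∀ {old} → cs ↭ old ++ rest → X ∈ old → Piece X
      pieceOf p X∈ = lookupPiece (∈-resp-↭ (↭-sym p) (∈-++⁺ˡ X∈))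

    good-∷ʳ : Good X → missedBy X y ≡ 0 → Good (X ++ [ y ])
    good-∷ʳ {y = y} g eq = good-++ (λ { x∈ (here refl) → missedBy≡0⇒▷ eq x∈ }) g good-[ y ]

    good-∷ : ∑ (miss x) Y ≡ 0 → Good Y → Good (x ∷ Y)
    good-∷ {x = x} eq g = good-++ (λ { (here refl) y∈ → miss≡0⇒▷ x _ (∑≡0⇒≡0 (miss x) y∈ eq) }) good-[ x ] g

    length-∷ʳ : ∀ (X : List A) y → length (X ++ [ y ]) ≡ suc (length X)
    length-∷ʳ X y = trans (length-++ X) (+-comm _ 1)

    -- Rearrangements that would raise the potential.

    module Moves (opt : Optimal cs) where
      open Optimal opt
      open +-*-Solver using (solve; _:+_; _:*_; _:=_; con)

      -- If all of X saw z, then z could move from Z to the piece X, which is at least as large and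
      -- not yet full.
      move-up : cs ↭ X ∷ Z ∷ rest → length Z ≤ length X → length X ℕ.< r → z ∈ Z → missedBy X z ≢ 0
      move-up {X = X} {Z = Z} {rest = rest} {z = z} p Z≤X X<r z∈ eq with ∈⇒↭ z∈
      ... | Z° , q = exchange opt (X ∷ Z ∷ []) {new = (X ++ [ z ]) ∷ Z° ∷ []} p
              ((good-∷ʳ (proj₁ pX) eq , subst (_≤ r) (sym (length-∷ʳ X z)) X<r)
                ∷ piece-++ʳ [ z ] (piece-↭ q pZ) ∷ [])
              same Φ<
        where
        pX : Piece X
        pX = pieceOf opt {old = X ∷ Z ∷ []} p (here refl)
        pZ : Piece Z
        pZ = pieceOf opt {old = X ∷ Z ∷ []} p (there (here refl))
        same : ∀ f → total f ((X ++ [ z ]) ∷ Z° ∷ []) ≡ total f (X ∷ Z ∷ [])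
        same f rewrite ∑-++ (f ∘ vert) X [ z ] | ∑-↭ (f ∘ vert) q =
          solve 3 (λ a b c → (a :+ (b :+ con 0)) :+ (c :+ con 0) := a :+ ((b :+ c) :+ con 0)) refl
              (∑ (f ∘ vert) X) (f (vert z)) (∑ (f ∘ vert) Z°)
        Φ< : Φ (X ∷ Z ∷ []) ℕ.< Φ ((X ++ [ z ]) ∷ Z° ∷ [])
        Φ< rewrite length-∷ʳ X z | ↭-length q = spread (length X) (length Z°) 0 Z≤X

      -- Here y would go to `X₁`, R would fill X up to size r, and Q would remain: sizes s, s, r
      -- become s + 1, r, s - 1.
      move-A : ∀ {s} → cs ↭ X₁ ∷ X ∷ Y ∷ rest → length X₁ ≡ s → length X ≡ s → s ℕ.< r → length Y ≡ r →
               Y ↭ y ∷ R ++ Q → length R + s ≡ r → missedBy X₁ y ≡ 0 → All (λ z → missedBy X z ≡ 0) R → ⊥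
      move-A {X₁ = X₁} {X = X} {Y = Y} {rest = rest} {y = y} {R = R} {Q = Q} {s = s} p lX₁ lX s<r lY q lR eq eqs =
        exchange opt (X₁ ∷ X ∷ Y ∷ []) {new = (X₁ ++ [ y ]) ∷ (X ++ R) ∷ Q ∷ []} p
          ((good-∷ʳ (proj₁ pX₁) eq , subst (_≤ r) (sym lX₁y) s<r)
            ∷ (good-++ (λ x∈ z∈ → missedBy≡0⇒▷ (All.lookup eqs z∈) x∈) (proj₁ pX) (proj₁ pR) , ≤-reflexive lXR)
            ∷ piece-++ʳ R pRQ ∷ [])
          same Φ<
        where
        old : List (List A)
        old = X₁ ∷ X ∷ Y ∷ []
        pX₁ : Piece X₁
        pX₁ = pieceOf opt {old = old} p (here refl)
        pX : Piece X
        pX = pieceOf opt {old = old} p (there (here refl))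
        pRQ : Piece (R ++ Q)
        pRQ = piece-++ʳ [ y ] (piece-↭ q (pieceOf opt {old = old} p (there (there (here refl)))))
        pR : Piece R
        pR = piece-++ʳ Q (piece-↭ (++-comm R Q) pRQ)
        lX₁y : length (X₁ ++ [ y ]) ≡ suc s
        lX₁y = trans (length-∷ʳ X₁ y) (cong suc lX₁)
        lXR : length (X ++ R) ≡ r
        lXR = trans (length-++ X) (trans (cong (_+ length R) lX) (trans (+-comm s _) lR))
        -- Besides the r - s elements of R, the piece Y also loses y, so Q has s - 1 elements.
        lQ : s ≡ suc (length Q)
        lQ = +-cancelˡ-≡ (length R) s _ (begin
          length R + s                ≡⟨ lR ⟩
          r                           ≡⟨ lY ⟨
          length Y                    ≡⟨ ↭-length q ⟩
          suc (length (R ++ Q))       ≡⟨ cong suc (length-++ R) ⟩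
          suc (length R + length Q)   ≡⟨ +-suc (length R) _ ⟨
          length R + suc (length Q)   ∎)
          where open ≡-Reasoning
        same : ∀ f → total f ((X₁ ++ [ y ]) ∷ (X ++ R) ∷ Q ∷ []) ≡ total f old
        same f rewrite ∑-++ (f ∘ vert) X₁ [ y ] | ∑-++ (f ∘ vert) X R | ∑-↭ (f ∘ vert) q | ∑-++ (f ∘ vert) R Q =
          solve 5 (λ a b c d e → (a :+ (b :+ con 0)) :+ ((c :+ d) :+ (e :+ con 0)) := a :+
              (c :+ ((b :+ (d :+ e)) :+ con 0))) refl
            (∑ (f ∘ vert) X₁) (f (vert y)) (∑ (f ∘ vert) X) (∑ (f ∘ vert) R) (∑ (f ∘ vert) Q)
        Φ< : Φ old ℕ.< Φ ((X₁ ++ [ y ]) ∷ (X ++ R) ∷ Q ∷ [])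
        Φ< = subst₂ ℕ._<_ (sym (Φ₃ X₁ X Y lX₁ (trans lX lQ) lY))
            (sym (Φ₃ (X₁ ++ [ y ]) (X ++ R) Q lX₁y lXR refl)) (spread₃ s (length Q) r (≤-reflexive (sym lQ)))

      -- Here y would go to `X₁` and x would take its place in Y: again sizes s, s, r become s + 1,
      -- r, s - 1.
      move-B : ∀ {s} → cs ↭ X₁ ∷ X ∷ Y ∷ rest → length X₁ ≡ s → length X ≡ s → s ℕ.< r → length Y ≡ r →
               Y ↭ y ∷ Y° → X ↭ x ∷ X° → missedBy X₁ y ≡ 0 → ∑ (miss x) Y° ≡ 0 → ⊥
      move-B {X₁ = X₁} {X = X} {Y = Y} {rest = rest} {y = y} {Y° = Y°} {x = x} {X° = X°} {s = s} p lX₁ lX s<r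
          lY q qX eq eqx =
        exchange opt old {new = new} p
          ((good-∷ʳ (proj₁ pX₁) eq , subst (_≤ r) (sym lX₁y) s<r)
            ∷ (good-∷ eqx (good-tail (good-↭ q (proj₁ pY))) , ≤-reflexive lxY)
            ∷ piece-++ʳ [ x ] (piece-↭ qX pX) ∷ [])
          same Φ<
        where
        old new : List (List A)
        old = X₁ ∷ X ∷ Y ∷ []
        new = (X₁ ++ [ y ]) ∷ (x ∷ Y°) ∷ X° ∷ []
        pX₁ : Piece X₁
        pX₁ = pieceOf opt {old = old} p (here refl)
        pX : Piece X
        pX = pieceOf opt {old = old} p (there (here refl))
        pY : Piece Y
        pY = pieceOf opt {old = old} p (there (there (here refl)))
        lX₁y : length (X₁ ++ [ y ]) ≡ suc s
        lX₁y = trans (length-∷ʳ X₁ y) (cong suc lX₁)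
        lxY : suc (length Y°) ≡ r
        lxY = trans (sym (↭-length q)) lY
        lX° : s ≡ suc (length X°)
        lX° = trans (sym lX) (↭-length qX)
        same : ∀ f → total f new ≡ total f old
        same f rewrite ∑-++ (f ∘ vert) X₁ [ y ] | ∑-↭ (f ∘ vert) q | ∑-↭ (f ∘ vert) qX =
          solve 5 (λ a b c d e → (a :+ (b :+ con 0)) :+ ((c :+ d) :+ (e :+ con 0)) := a :+
              ((c :+ e) :+ ((b :+ d) :+ con 0))) refl
            (∑ (f ∘ vert) X₁) (f (vert y)) (f (vert x)) (∑ (f ∘ vert) Y°) (∑ (f ∘ vert) X°)
        Φ< : Φ old ℕ.< Φ new
        Φ< = subst₂ ℕ._<_ (sym (Φ₃ X₁ X Y lX₁ (trans lX lX°) lY))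
            (sym (Φ₃ (X₁ ++ [ y ]) (x ∷ Y°) X° lX₁y lxY refl)) (spread₃ s (length X°) r (≤-reflexive (sym lX°)) )

      -- In X, the element x would be replaced by a and w; x would take the place of `y₁` in `Y₁`,
      -- and `x₁` that of w in Y. Sizes s, s, r, r become s + 1, r, r, s - 1. The element a has the
      -- vertex of `y₁`, possibly with the other neighbourhood.
      move-C : ∀ {s} → cs ↭ X₁ ∷ X ∷ Y ∷ Y₁ ∷ rest → length X₁ ≡ s → length X ≡ s → s ℕ.< r → length Y ≡ r →
          length Y₁ ≡ r →
               X ↭ x ∷ X° → X₁ ↭ x₁ ∷ X₁° → Y ↭ w ∷ Y° → Y₁ ↭ y₁ ∷ Y₁° → vert a ≡ vert y₁ →
               missedBy X° w ≡ 0 → missedBy X° y₁ ≡ 0 → ∑ (miss x) Y₁° ≡ 0 → ∑ (miss x₁) Y° ≡ 0 → ¬ a ▷ w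
      move-C {X₁ = X₁} {X = X} {Y = Y} {Y₁ = Y₁} {rest = rest} {x = x} {X° = X°} {x₁ = x₁} {X₁° = X₁°} {w = w}
          {Y° = Y°} {y₁ = y₁} {Y₁° = Y₁°} {a = a} {s = s}
             p lX₁ lX s<r lY lY₁ qX qX₁ q q₁ va eqw eqy eqx eqx₁ aw =
        exchange opt old {new = new} p
          ((good-++ sees-aw (good-tail (good-↭ qX (proj₁ pX))) good-aw , subst (_≤ r) (sym lnew) s<r)
            ∷ (good-∷ eqx (good-tail (good-↭ q₁ (proj₁ pY₁))) , ≤-reflexive lxY₁)
            ∷ (good-∷ eqx₁ (good-tail (good-↭ q (proj₁ pY))) , ≤-reflexive lxY)
            ∷ piece-++ʳ [ x₁ ] (piece-↭ qX₁ pX₁) ∷ [])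
          same Φ<
        where
        old new : List (List A)
        old = X₁ ∷ X ∷ Y ∷ Y₁ ∷ []
        new = (X° ++ a ∷ w ∷ []) ∷ (x ∷ Y₁°) ∷ (x₁ ∷ Y°) ∷ X₁° ∷ []
        pX₁ : Piece X₁
        pX₁ = pieceOf opt {old = old} p (here refl)
        pX : Piece X
        pX = pieceOf opt {old = old} p (there (here refl))
        pY : Piece Y
        pY = pieceOf opt {old = old} p (there (there (here refl)))
        pY₁ : Piece Y₁
        pY₁ = pieceOf opt {old = old} p (there (there (there (here refl))))
        sees-aw : ∀ {u v} → u ∈ X° → v ∈ a ∷ w ∷ [] → u ▷ v
        sees-aw {u} u∈ (here refl)         = subst (λ v → sees u v ≡ true) (sym va) (missedBy≡0⇒▷ eqy u∈)
        sees-aw     u∈ (there (here refl)) = missedBy≡0⇒▷ eqw u∈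
        good-aw : Good (a ∷ w ∷ [])
        good-aw = a ∷ w ∷ [] , ↭-refl , (aw ∷ []) ∷ [] ∷ []
        lX° : suc (length X°) ≡ s
        lX° = trans (sym (↭-length qX)) lX
        lnew : length (X° ++ a ∷ w ∷ []) ≡ suc s
        lnew = trans (length-++ X°) (trans (+-comm (length X°) 2) (cong suc lX°))
        lxY : suc (length Y°) ≡ r
        lxY = trans (sym (↭-length q)) lY
        lxY₁ : suc (length Y₁°) ≡ r
        lxY₁ = trans (sym (↭-length q₁)) lY₁
        lX₁° : s ≡ suc (length X₁°)
        lX₁° = trans (sym lX₁) (↭-length qX₁)
        same : ∀ f → total f new ≡ total f old
        same f rewrite ∑-++ (f ∘ vert) X° (a ∷ w ∷ []) | ∑-↭ (f ∘ vert) q | ∑-↭ (f ∘ vert) q₁ | ∑-↭ (f ∘ vert)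
            qX | ∑-↭ (f ∘ vert) qX₁ | va =
          solve 8 (λ X° a w x Y₁ x₁ Y X₁ → (X° :+ (a :+ (w :+ con 0))) :+
              ((x :+ Y₁) :+ ((x₁ :+ Y) :+ (X₁ :+ con 0)))
                      := (x₁ :+ X₁) :+ ((x :+ X°) :+ ((w :+ Y) :+ ((a :+ Y₁) :+ con 0)))) refl
            (∑ (f ∘ vert) X°) (f (vert y₁)) (f (vert w)) (f (vert x)) (∑ (f ∘ vert) Y₁°) (f (vert x₁))
                (∑ (f ∘ vert) Y°) (∑ (f ∘ vert) X₁°)
        Φ< : Φ old ℕ.< Φ new
        Φ< = subst₂ ℕ._<_ (sym (Φ₄ X₁ X Y Y₁ lX₁ (trans lX lX₁°) lY lY₁))
            (sym (Φ₄ (X° ++ a ∷ w ∷ []) (x ∷ Y₁°) (x₁ ∷ Y°) X₁° lnew lxY₁ lxY refl))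
            (spread₄ s (length X₁°) r (≤-reflexive (sym lX₁°)))

    -- How two pieces of size s miss a full piece.

    seen? : ∀ X z → Dec (missedBy X z ≡ 0)
    seen? X z = missedBy X z ≟ 0

    seenBy : List A → List A → ℕ
    seenBy X = ∑ (𝟙 ∘ seen? X)

    1≤seen+missed : ∀ X z → 1 ≤ 𝟙 (seen? X z) + missedBy X z
    1≤seen+missed X z with missedBy X z
    ... | zero  = ≤-refl
    ... | suc _ = s≤s z≤n

    -- An element of Y is seen by all of X or contributes at least one miss.
    length≤seenBy+μ : ∀ X Y → length Y ≤ seenBy X Y + μ X Y
    length≤seenBy+μ X Y = subst₂ _≤_ (*-identityʳ _) (∑-+ _ _ Y) (∑-≥ 1 Y λ {z} _ → 1≤seen+missed X z)

    -- As in `length≤seenBy+μ`, but w alone contributes two misses.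
    length<seenBy+μ : ∀ X {Y w} → w ∈ Y → 2 ≤ missedBy X w → length Y ℕ.< seenBy X Y + μ X Y
    length<seenBy+μ X {Y} {w} w∈ 2≤ with ∈⇒↭ w∈
    ... | Y° , q = begin
      suc (length Y)                                                           ≡⟨ cong suc (↭-length q) ⟩
      2 + length Y°
        ≤⟨ +-mono-≤ (≤-trans 2≤ (m≤n+m _ (𝟙 (seen? X w)))) (length≤seenBy+μ X Y°) ⟩
      (𝟙 (seen? X w) + missedBy X w) + (seenBy X Y° + μ X Y°)
        ≡⟨ interchange (𝟙 (seen? X w)) _ _ _ ⟩
      (𝟙 (seen? X w) + seenBy X Y°) + (missedBy X w + μ X Y°)                  ≡⟨ cong₂ _+_ (∑-↭ _ q) (∑-↭ _ q) ⟨
      seenBy X Y + μ X Y                                                       ∎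
      where open ≤-Reasoning

    module Typical (opt : Optimal cs) {s} (s<r : s ℕ.< r) where
      open Moves opt

      -- Otherwise r - s elements of `Y°` that all of X sees could serve as the R of `move-A`.
      block-A : cs ↭ X₁ ∷ X ∷ Y ∷ rest → length X₁ ≡ s → length X ≡ s → length Y ≡ r →
                Y ↭ y ∷ Y° → missedBy X₁ y ≡ 0 → ¬ r ≤ s + seenBy X Y°
      block-A {X = X} {Y° = Y°} p lX₁ lX lY q eq r≤ with extract (seen? X) (r ∸ s) Y° (m≤n+o⇒m∸n≤o r s r≤)
      ... | R , Q , q′ , lR , seen = move-A p lX₁ lX s<r lY (↭-trans q (prep _ q′))
          (trans (cong (_+ s) lR) (m∸n+n≡m (<⇒≤ s<r))) eq seen

      -- With at most s - 1 misses, X would see at least (r - 1) - (s - 1) = r - s elements of `Y°`,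
      -- against `block-A`.
      s≤μ-remaining : cs ↭ X₁ ∷ X ∷ Y ∷ rest → length X₁ ≡ s → length X ≡ s → length Y ≡ r →
                      Y ↭ y ∷ Y° → missedBy X₁ y ≡ 0 → s ≤ μ X Y°
      s≤μ-remaining {X = X} {Y = Y} {Y° = Y°} p lX₁ lX lY q eq = ≮⇒≥ λ μ<s → block-A p lX₁ lX lY q eq (begin
        r                            ≡⟨ lY ⟨
        length Y                     ≡⟨ ↭-length q ⟩
        suc (length Y°)              ≤⟨ s≤s (length≤seenBy+μ X Y°) ⟩
        suc (seenBy X Y° + μ X Y°)   ≡⟨ +-suc (seenBy X Y°) _ ⟨
        seenBy X Y° + suc (μ X Y°)   ≤⟨ +-monoʳ-≤ (seenBy X Y°) μ<s ⟩
        seenBy X Y° + s              ≡⟨ +-comm _ s ⟩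
        s + seenBy X Y°              ∎)
        where open ≤-Reasoning

      -- An element of Y seen by all of `X₁` would force s misses of X on the rest of Y.
      μ<s⇒missed : cs ↭ X₁ ∷ X ∷ Y ∷ rest → length X₁ ≡ s → length X ≡ s → length Y ≡ r →
                   μ X Y ℕ.< s → y ∈ Y → missedBy X₁ y ≢ 0
      μ<s⇒missed {X = X} {y = y} p lX₁ lX lY μ<s y∈ eq with ∈⇒↭ y∈
      ... | Y° , q = <⇒≱ μ<s (≤-trans (s≤μ-remaining p lX₁ lX lY q eq)
          (≤-trans (m≤n+m _ (missedBy X y)) (≤-reflexive (sym (∑-↭ (missedBy X) q)))))

      -- If `X₁` sees y, the rest of Y absorbs all s misses of X, and none is left for y. Hence the
      -- set of missed elements does not depend on the piece of size s.
      seen-transfer : cs ↭ X₁ ∷ X ∷ Y ∷ rest → length X₁ ≡ s → length X ≡ s → length Y ≡ r →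
                      μ X Y ≡ s → y ∈ Y → missedBy X₁ y ≡ 0 → missedBy X y ≡ 0
      seen-transfer {X = X} {Y = Y} {y = y} p lX₁ lX lY μ≡s y∈ eq with ∈⇒↭ y∈
      ... | Y° , q = n≤0⇒n≡0 (+-cancelʳ-≤ (μ X Y°) (missedBy X y) 0 (begin
        missedBy X y + μ X Y°  ≡⟨ ∑-↭ (missedBy X) q ⟨
        μ X Y                  ≡⟨ μ≡s ⟩
        s                      ≤⟨ s≤μ-remaining p lX₁ lX lY q eq ⟩
        μ X Y°                 ∎))
        where open ≤-Reasoning

      some-seen : length Y ≡ r → μ X Y ≡ s → ∃ λ y → y ∈ Y × missedBy X y ≡ 0
      some-seen {Y = Y} {X = X} lY μ≡s = ∑<length⇒∃zero (missedBy X) Y (subst₂ ℕ._<_ (sym μ≡s) (sym lY) s<r)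

      -- Take y seen by `X₁`. If w were missed twice, the s misses of X would hit at most s - 1
      -- elements, and the other r - s beside y would contradict `block-A`.
      missedBy≤1 : cs ↭ X₁ ∷ X ∷ Y ∷ rest → length X₁ ≡ s → length X ≡ s → length Y ≡ r →
                   μ X₁ Y ≡ s → μ X Y ≡ s → w ∈ Y → missedBy X w ≤ 1
      missedBy≤1 {X₁ = X₁} {X = X} {Y = Y} {w = w} p lX₁ lX lY μ₁≡s μ≡s w∈ with some-seen {X = X₁} lY μ₁≡s
      ... | y , y∈ , eq with ∈⇒↭ y∈
      ... | Y° , q = ≮⇒≥ λ 2≤ → block-A p lX₁ lX lY q eq (begin
        r                        ≡⟨ lY ⟨
        length Y                 ≡⟨ ↭-length q ⟩
        suc (length Y°)          ≤⟨ length<seenBy+μ X (in-rest 2≤ (∈-resp-↭ q w∈)) 2≤ ⟩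
        seenBy X Y° + μ X Y°
          ≤⟨ +-monoʳ-≤ (seenBy X Y°) (≤-trans (m≤n+m _ (missedBy X y))
              (≤-reflexive (trans (sym (∑-↭ (missedBy X) q)) μ≡s))) ⟩
        seenBy X Y° + s          ≡⟨ +-comm _ s ⟩
        s + seenBy X Y°          ∎)
        where
        open ≤-Reasoning
        -- By `seen-transfer` X sees y too, so w is not y.
        in-rest : 2 ≤ missedBy X w → w ∈ y ∷ Y° → w ∈ Y°
        in-rest 2≤ (here refl) = ⊥-elim (n≮0 (subst (1 ℕ.<_) (seen-transfer p lX₁ lX lY μ≡s w∈ eq) 2≤))
        in-rest _  (there w∈)  = w∈

      -- By `move-B` each of the s elements of X misses something in Y, and there are only s misses.
      misses-one : cs ↭ X₁ ∷ X ∷ Y ∷ rest → length X₁ ≡ s → length X ≡ s → length Y ≡ r →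
                   μ X₁ Y ≡ s → μ X Y ≡ s → x ∈ X → ∑ (miss x) Y ≡ 1
      misses-one {X₁ = X₁} {X = X} {Y = Y} p lX₁ lX lY μ₁≡s μ≡s =
        ∑≡length⇒≡1 (λ x → ∑ (miss x) Y) X positive (trans (∑-swap miss X Y) (trans μ≡s (sym lX)))
        where
        positive : ∀ {z} → z ∈ X → 1 ≤ ∑ (miss z) Y
        positive {z} z∈ = n≢0⇒n>0 λ eq₀ → sees-everything eq₀ (some-seen {X = X₁} lY μ₁≡s)
          where
          sees-everything : ∑ (miss z) Y ≡ 0 → ¬ ∃ λ y → y ∈ Y × missedBy X₁ y ≡ 0
          sees-everything eq₀ (y , y∈ , eq) with ∈⇒↭ y∈ | ∈⇒↭ z∈
          ... | Y° , q | X° , qX = move-B p lX₁ lX s<r lY q qX eq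
            (n≤0⇒n≡0 (≤-trans (m≤n+m _ (miss z y)) (≤-reflexive (trans (sym (∑-↭ (miss z) q)) eq₀))))

      swap-first : cs ↭ X₁ ∷ X ∷ rest → cs ↭ X ∷ X₁ ∷ rest
      swap-first p = ↭-trans p (Perm.swap _ _ ↭-refl)

      others-see : cs ↭ X₁ ∷ X ∷ Y ∷ rest → length X₁ ≡ s → length X ≡ s → length Y ≡ r →
                   μ X₁ Y ≡ s → μ X Y ≡ s → X ↭ x ∷ X° → w ∈ Y → miss x w ≡ 1 → missedBy X° w ≡ 0
      others-see {X = X} {x = x} {X° = X°} {w = w} p lX₁ lX lY μ₁≡s μ≡s qX w∈ eq = n≤0⇒n≡0 (+-cancelˡ-≤ 1 _ 0 (begin
        1 + missedBy X° w         ≡⟨ cong (_+ missedBy X° w) eq ⟨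
        miss x w + missedBy X° w  ≡⟨ ∑-↭ (λ x → miss x w) qX ⟨
        missedBy X w              ≤⟨ missedBy≤1 p lX₁ lX lY μ₁≡s μ≡s w∈ ⟩
        1                         ∎))
        where open ≤-Reasoning

      sees-rest : cs ↭ X₁ ∷ X ∷ Y ∷ rest → length X₁ ≡ s → length X ≡ s → length Y ≡ r →
                  μ X₁ Y ≡ s → μ X Y ≡ s → x ∈ X → Y ↭ w ∷ Y° → miss x w ≡ 1 → ∑ (miss x) Y° ≡ 0
      sees-rest {x = x} {Y° = Y°} p lX₁ lX lY μ₁≡s μ≡s x∈ q eq =
        suc-injective (trans (cong (_+ ∑ (miss x) Y°) (sym eq))
            (trans (sym (∑-↭ (miss x) q)) (misses-one p lX₁ lX lY μ₁≡s μ≡s x∈)))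

      -- The element x is exchanged for y₁; if y₁ saw w, then w could join as well,
      -- since its place in Y can be taken over by an element of X₁.
      missed-independent : cs ↭ X₁ ∷ X ∷ Y ∷ Y₁ ∷ rest → length X₁ ≡ s → length X ≡ s → length Y ≡ r → length
          Y₁ ≡ r →
                           μ X₁ Y ≡ s → μ X Y ≡ s → μ X₁ Y₁ ≡ s → μ X Y₁ ≡ s → x ∈ X →
                           w ∈ Y → miss x w ≡ 1 → y₁ ∈ Y₁ → miss x y₁ ≡ 1 → vert a ≡ vert y₁ → ¬ a ▷ w
      missed-independent {X₁ = X₁} {X = X} {Y = Y} {Y₁ = Y₁} {rest = rest} {x = x} {w = w} {y₁ = y₁} {a = a}
        p lX₁ lX lY lY₁ μ₁Y μY μ₁Y₁ μY₁ x∈ w∈ eqw y₁∈ eqy₁ va =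
        replace (∈⇒↭ x∈) (∈⇒↭ w∈) (∈⇒↭ y₁∈) (∑≢0⇒∃ (λ x → miss x w) X₁ missed)
        where
        p₁ : cs ↭ X₁ ∷ X ∷ Y₁ ∷ Y ∷ rest
        p₁ = ↭-trans p (prep X₁ (prep X (Perm.swap Y Y₁ ↭-refl)))
        -- Since X misses w, so does `X₁`. An element of `X₁` that misses w sees the rest of Y and
        -- can replace w there.
        missed : missedBy X₁ w ≢ 0
        missed eq = 1+n≢0 (trans (sym eqw) (∑≡0⇒≡0 (λ x → miss x w) x∈ (seen-transfer p lX₁ lX lY μY w∈ eq)))
        replace : (∃ λ X° → X ↭ x ∷ X°) → (∃ λ Y° → Y ↭ w ∷ Y°) → (∃ λ Y₁° → Y₁ ↭ y₁ ∷ Y₁°) →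
                  (∃ λ x₁ → x₁ ∈ X₁ × miss x₁ w ≢ 0) → ¬ a ▷ w
        replace (X° , qX) (Y° , q) (Y₁° , q₁) (x₁ , x₁∈ , eq₁) with ∈⇒↭ x₁∈
        ... | X₁° , qX₁ = move-C {x = x} {X° = X°} {x₁ = x₁} {X₁° = X₁°} {w = w} {Y° = Y°} {y₁ = y₁}
            {Y₁° = Y₁°} {a = a}
          p lX₁ lX s<r lY lY₁ qX qX₁ q q₁ va
          (others-see {X = X} {x = x} {X° = X°} {w = w} p lX₁ lX lY μ₁Y μY qX w∈ eqw)
          (others-see {X = X} {x = x} {X° = X°} {w = y₁} p₁ lX₁ lX lY₁ μ₁Y₁ μY₁ qX y₁∈ eqy₁)
          (sees-rest {X = X} {x = x} {w = y₁} {Y° = Y₁°} p₁ lX₁ lX lY₁ μ₁Y₁ μY₁ x∈ q₁ eqy₁)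
          (sees-rest {X = X₁} {x = x₁} {w = w} {Y° = Y°} (swap-first p) lX lX₁ lY μY μ₁Y x₁∈ q
              (≤-antisym (miss≤1 x₁ w) (n≢0⇒n>0 eq₁)))

    -- Counting the vertices that r + 1 pieces of size s miss.

    between? : ∀ s (Z : List A) → Dec (s ℕ.< length Z × length Z ℕ.< r)
    between? s Z = (s <? length Z) ×-dec (length Z <? r)

    betweens : ℕ → List (List A) → ℕ
    betweens s = ∑ (λ Z → 𝟙 (between? s Z))

    module Counting (irrefl : ∀ a → sees a (vert a) ≡ false) (opt : Optimal cs) {s : ℕ} (s<r : s ℕ.< r)
                    {Xs : List (List A)} (split : cs ↭ Xs ++ rest)
                    (lXs : length Xs ≡ suc r) (lens : All (λ X → length X ≡ s) Xs) where
      open Moves opt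
      open Typical opt s<r

      private variable
        Xs′ Xs″ : List (List A)

      length-Xs : X ∈ Xs → length X ≡ s
      length-Xs = All.lookup lens

      Xs⊆cs : X ∈ Xs → X ∈ cs
      Xs⊆cs X∈ = ∈-resp-↭ (↭-sym split) (∈-++⁺ˡ X∈)

      full∈rest : Y ∈ cs → length Y ≡ r → Y ∈ rest
      full∈rest Y∈ lY with ∈-++⁻ Xs (∈-resp-↭ split Y∈)
      ... | inj₁ Y∈Xs   = ⊥-elim (<⇒≢ s<r (trans (sym (length-Xs Y∈Xs)) lY))
      ... | inj₂ Y∈rest = Y∈rest

      pull : Xs ↭ X ∷ Xs′ → Xs′ ↭ X₁ ∷ Xs″ → rest ↭ Y ∷ cs′ → cs ↭ X₁ ∷ X ∷ Y ∷ Xs″ ++ cs′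
      pull {X = X} {X₁ = X₁} {Xs″ = Xs″} {Y = Y} {cs′ = cs′} p q q′ =
        ↭-trans split (↭-trans (↭-++⁺ (↭-trans p (↭-trans (prep X q) (Perm.swap X X₁ ↭-refl))) q′)
          (prep X₁ (prep X (shift Y Xs″ cs′))))

      pair : Xs ↭ X ∷ Xs′ → X₁ ∈ Xs′ → Y ∈ cs → length Y ≡ r → ∃ λ cs′ → cs ↭ X₁ ∷ X ∷ Y ∷ cs′
      pair p X₁∈ Y∈ lY with ∈⇒↭ X₁∈ | ∈⇒↭ (full∈rest Y∈ lY)
      ... | _ , q | _ , q′ = _ , pull p q q′

      -- Every element of Z is missed by X: by `move-up` if Z is another piece, and if Z is X itself
      -- because no element sees its own vertex.
      small-missed : Z ∈ cs → length Z ≤ s → X ∈ Xs → length Z ≤ μ X Z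
      small-missed {Z = Z} {X = X} Z∈ Z≤s X∈ = subst (_≤ μ X Z) (*-identityʳ _) (∑-≥ 1 Z λ z∈ → n≢0⇒n>0 (missed z∈))
        where
        missed : ∀ {z} → z ∈ Z → missedBy X z ≢ 0
        missed {z} z∈ eq with ∈⇒↭ (Xs⊆cs X∈)
        ... | cs₁ , p with ∈-resp-↭ p Z∈
        ...   | here refl = seesItself (missedBy≡0⇒▷ {y = z} eq z∈)
          where
          seesItself : ¬ sees z (vert z) ≡ true
          seesItself t with () ← trans (sym t) (irrefl z)
        ...   | there Z∈₁ with ∈⇒↭ Z∈₁
        ...     | cs₂ , q = move-up (↭-trans p (prep X q)) (subst (length Z ≤_) (sym (length-Xs X∈)) Z≤s)
            (subst (ℕ._< r) (sym (length-Xs X∈)) s<r) z∈ eq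

      misses : List A → ℕ
      misses Z = ∑ (λ X → μ X Z) Xs

      typical? : ∀ Z → Dec (length Z ≡ r × All (λ X → μ X Z ≡ s) Xs)
      typical? Z = (length Z ≟ r) ×-dec All.all? (λ X → μ X Z ≟ s) Xs

      -- Summed over the tiling, this counts the vertices outside the typical pieces.
      bad : List A → ℕ
      bad Z = if does (typical? Z) then 0 else length Z

      bad≤length : ∀ Z → bad Z ≤ length Z
      bad≤length Z with does (typical? Z)
      ... | true  = z≤n
      ... | false = ≤-refl

      -- If every X misses Y at least s times, one of them does so more than s times. If some X
      -- misses it fewer than s times, then by `μ<s⇒missed` the other r pieces miss all r elements,
      -- and `product-bound` applies.
      nontypical-misses : Y ∈ cs → length Y ≡ r → ¬ All (λ X → μ X Y ≡ s) Xs → suc (suc r * s) ≤ misses Y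
      nontypical-misses {Y = Y} Y∈ lY ¬typ with All.all? (λ X → s ≤? μ X Y) Xs
      ... | yes all≥ with find (All.¬All⇒Any¬ (λ X → μ X Y ≟ s) Xs ¬typ)
      ...   | X , X∈ , μ≢s with ∈⇒↭ X∈
      ...     | Xs′ , p = begin
        suc (suc r * s)                       ≡⟨ cong (λ k → suc (k * s)) (trans (sym lXs) (↭-length p)) ⟩
        suc s + length Xs′ * s
          ≤⟨ +-mono-≤ (≤∧≢⇒< (All.lookup all≥ X∈) (μ≢s ∘ sym))
              (∑-≥ s Xs′ λ X′∈ → All.lookup all≥ (∈-resp-↭ (↭-sym p) (there X′∈))) ⟩
        μ X Y + ∑ (λ X′ → μ X′ Y) Xs′         ≡⟨ ∑-↭ _ p ⟨
        misses Y                              ∎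
        where open ≤-Reasoning
      nontypical-misses {Y = Y} Y∈ lY ¬typ | no ¬all≥ with find (All.¬All⇒Any¬ (λ X → s ≤? μ X Y) Xs ¬all≥)
      ...   | X , X∈ , s≰μ with ∈⇒↭ X∈
      ...     | Xs′ , p = begin
        suc (suc r * s)                       ≤⟨ product-bound s<r ⟩
        r * r                                 ≡⟨ cong (_* r) (suc-injective (trans (sym lXs) (↭-length p))) ⟩
        length Xs′ * r                        ≤⟨ ∑-≥ r Xs′ all-missed ⟩
        ∑ (λ X′ → μ X′ Y) Xs′                 ≤⟨ m≤n+m _ (μ X Y) ⟩
        μ X Y + ∑ (λ X′ → μ X′ Y) Xs′         ≡⟨ ∑-↭ _ p ⟨
        misses Y                              ∎
        where
        open ≤-Reasoning
        all-missed : ∀ {X₁} → X₁ ∈ Xs′ → r ≤ μ X₁ Y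
        all-missed {X₁} X₁∈ with pair p X₁∈ Y∈ lY
        ... | _ , p′ = subst (_≤ μ X₁ Y) (trans (*-identityʳ _) lY) (∑-≥ 1 Y λ y∈ → n≢0⇒n>0
              (μ<s⇒missed p′ (length-Xs (∈-resp-↭ (↭-sym p) (there X₁∈))) (length-Xs X∈) lY (≰⇒> s≰μ) y∈))

      -- A bound, free of s, on the left-hand side of `piece-count` for pieces with fewer than r
      -- elements.
      slack : ℕ
      slack = suc r * r * r + r

      -- On average, each of the (r + 1)s elements of `Xs` misses at least 1/r of every piece, with
      -- a surplus when the piece is not typical. Only the pieces of size strictly between s and r
      -- escape; they are paid for by `slack`.
      piece-count : Z ∈ cs → suc r * s * length Z + bad Z ≤ r * misses Z + slack * 𝟙 (between? s Z)
      piece-count {Z = Z} Z∈ with length Z ≤? s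
      ... | yes Z≤s = begin
        suc r * s * length Z + bad Z                     ≤⟨ +-monoʳ-≤ (suc r * s * length Z) (bad≤length Z) ⟩
        suc r * s * length Z + length Z                  ≤⟨ small-bound (length Z) s<r ⟩
        r * (suc r * length Z)                           ≡⟨ cong (λ k → r * (k * length Z)) lXs ⟨
        r * (length Xs * length Z)                       ≤⟨ *-monoʳ-≤ r (∑-≥ (length Z) Xs (small-missed Z∈ Z≤s)) ⟩
        r * misses Z                                     ≤⟨ m≤m+n _ _ ⟩
        r * misses Z + slack * 𝟙 (between? s Z)            ∎
        where open ≤-Reasoning
      ... | no Z≰s with length Z <? r
      ...   | yes Z<r = begin
        suc r * s * length Z + bad Z
          ≤⟨ +-mono-≤ (*-mono-≤ (*-monoʳ-≤ (suc r) (<⇒≤ s<r)) (<⇒≤ Z<r)) (≤-trans (bad≤length Z) (<⇒≤ Z<r)) ⟩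
        slack                                            ≡⟨ *-identityʳ slack ⟨
        slack * 1                                        ≡⟨ cong (slack *_) (𝟙-yes (between? s Z) (≰⇒> Z≰s , Z<r)) ⟨
        slack * 𝟙 (between? s Z)                           ≤⟨ m≤n+m _ (r * misses Z) ⟩
        r * misses Z + slack * 𝟙 (between? s Z)            ∎
        where open ≤-Reasoning
      ...   | no Z≮r = ≤-trans (full (typical? Z)) (m≤m+n _ _)
        where
        open ≤-Reasoning
        lZ : length Z ≡ r
        lZ = ≤-antisym (proj₂ (lookupPiece opt Z∈)) (≮⇒≥ Z≮r)
        full : (d : Dec (length Z ≡ r × All (λ X → μ X Z ≡ s) Xs)) →
               suc r * s * length Z + (if does d then 0 else length Z) ≤ r * misses Z
        full (yes (_ , typ)) = begin
          suc r * s * length Z + 0   ≡⟨ +-identityʳ _ ⟩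
          suc r * s * length Z       ≡⟨ *-comm (suc r * s) (length Z) ⟩
          length Z * (suc r * s)     ≡⟨ cong₂ (λ k l → k * (l * s)) lZ (sym lXs) ⟩
          r * (length Xs * s)        ≤⟨ *-monoʳ-≤ r (∑-≥ s Xs λ X∈ → ≤-reflexive (sym (All.lookup typ X∈))) ⟩
          r * misses Z               ∎
        full (no ¬typ) = begin
          suc r * s * length Z + length Z   ≡⟨ +-comm _ (length Z) ⟩
          length Z + suc r * s * length Z   ≡⟨⟩
          suc (suc r * s) * length Z        ≡⟨ *-comm (suc (suc r * s)) (length Z) ⟩
          length Z * suc (suc r * s)        ≡⟨ cong (_* suc (suc r * s)) lZ ⟩
          r * suc (suc r * s)               ≤⟨ *-monoʳ-≤ r (nontypical-misses Z∈ lZ (λ typ → ¬typ (lZ , typ))) ⟩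
          r * misses Z                      ∎

      order : ℕ
      order = ∑ (length {A = A}) cs

      missTotal : A → ℕ
      missTotal x = ∑ (∑ (miss x)) cs

      misses-total : ∑ misses cs ≡ ∑ (∑ missTotal) Xs
      misses-total = trans (∑-swap (λ Z X → μ X Z) cs Xs) (∑-cong Xs λ {X} _ →
        trans (∑-cong cs λ {Z} _ → sym (∑-swap miss X Z)) (∑-swap (λ Z x → ∑ (miss x) Z) cs X))

      -- By `deg` an element misses at most (1/r + 1/q) times `order`, hardly more than the share
      -- 1/r that `piece-count` forces on average. The nontypical pieces have to fit into the
      -- difference.
      bad-bound : ∀ q → (∀ x → q * r * missTotal x ≤ (q + r) * order) →
                  ∀ k → betweens s cs ≤ k →
                  q * ∑ bad cs ≤ suc r * s * (r * order) + q * (slack * k)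
      bad-bound q deg k few = +-cancelˡ-≤ (q * (suc r * s * order)) _ _ (begin
        q * (suc r * s * order) + q * ∑ bad cs                    ≡⟨ *-distribˡ-+ q _ _ ⟨
        q * (suc r * s * order + ∑ bad cs)                        ≤⟨ *-monoʳ-≤ q summed ⟩
        q * (r * ∑ misses cs + slack * betweens s cs)
          ≤⟨ *-monoʳ-≤ q (+-monoʳ-≤ (r * ∑ misses cs) (*-monoʳ-≤ slack few)) ⟩
        q * (r * ∑ misses cs + slack * k)                         ≡⟨ *-distribˡ-+ q _ _ ⟩
        q * (r * ∑ misses cs) + q * (slack * k)                   ≤⟨ +-monoˡ-≤ (q * (slack * k)) misses≤ ⟩
        suc r * s * ((q + r) * order) + q * (slack * k)
          ≡⟨ regroup q r order (suc r * s) (q * (slack * k)) ⟩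
        q * (suc r * s * order) + (suc r * s * (r * order) + q * (slack * k)) ∎)
        where
        open ≤-Reasoning
        regroup : ∀ q r n c e → c * ((q + r) * n) + e ≡ q * (c * n) + (c * (r * n) + e)
        regroup = solve 5 (λ q r n c e → c :* ((q :+ r) :* n) :+ e := q :* (c :* n) :+ (c :* (r :* n) :+ e)) refl
          where open +-*-Solver
        summed : suc r * s * order + ∑ bad cs ≤ r * ∑ misses cs + slack * betweens s cs
        summed = begin
          suc r * s * order + ∑ bad cs
            ≡⟨ cong (_+ ∑ bad cs) (∑-* (suc r * s) (length {A = A}) cs) ⟨
          ∑ (λ Z → suc r * s * length Z) cs + ∑ bad cs                         ≡⟨ ∑-+ _ bad cs ⟨
          ∑ (λ Z → suc r * s * length Z + bad Z) cs                            ≤⟨ ∑-mono cs piece-count ⟩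
          ∑ (λ Z → r * misses Z + slack * 𝟙 (between? s Z)) cs
            ≡⟨ ∑-+ (λ Z → r * misses Z) (λ Z → slack * 𝟙 (between? s Z)) cs ⟩
          ∑ (λ Z → r * misses Z) cs + ∑ (λ Z → slack * 𝟙 (between? s Z)) cs
            ≡⟨ cong₂ _+_ (∑-* r misses cs) (∑-* slack (λ Z → 𝟙 (between? s Z)) cs) ⟩
          r * ∑ misses cs + slack * betweens s cs                        ∎
        misses≤ : q * (r * ∑ misses cs) ≤ suc r * s * ((q + r) * order)
        misses≤ = begin
          q * (r * ∑ misses cs)                        ≡⟨ *-assoc q r _ ⟨
          q * r * ∑ misses cs                          ≡⟨ cong (q * r *_) misses-total ⟩
          q * r * ∑ (∑ missTotal) Xs                   ≡⟨ ∑-* (q * r) (∑ missTotal) Xs ⟨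
          ∑ (λ X → q * r * ∑ missTotal X) Xs           ≤⟨ ∑-≤ (s * ((q + r) * order)) Xs per-piece ⟩
          length Xs * (s * ((q + r) * order))          ≡⟨ cong (_* (s * ((q + r) * order))) lXs ⟩
          suc r * (s * ((q + r) * order))              ≡⟨ *-assoc (suc r) s _ ⟨
          suc r * s * ((q + r) * order)                ∎
          where
          per-piece : ∀ {X} → X ∈ Xs → q * r * ∑ missTotal X ≤ s * ((q + r) * order)
          per-piece {X} X∈ = begin
            q * r * ∑ missTotal X                ≡⟨ ∑-* (q * r) missTotal X ⟨
            ∑ (λ x → q * r * missTotal x) X      ≤⟨ ∑-≤ ((q + r) * order) X (λ {x} _ → deg x) ⟩
            length X * ((q + r) * order)         ≡⟨ cong (_* ((q + r) * order)) (length-Xs X∈) ⟩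
            s * ((q + r) * order)                ∎

      partner : X ∈ Xs → ∃₂ λ X₁ Xs′ → Xs ↭ X ∷ X₁ ∷ Xs′ × X₁ ∈ Xs
      partner {X = X} X∈ with ∈⇒↭ X∈
      -- There are r + 1 ≥ 2 pieces in `Xs`, as r > s.
      ... | []      , p = ⊥-elim (n≮0 (subst (s ℕ.<_) (suc-injective (trans (sym lXs) (↭-length p))) s<r))
      ... | X₁ ∷ Xs′ , p = X₁ , Xs′ , p , ∈-resp-↭ (↭-sym p) (there (here refl))

      IsTypical : List A → Set
      IsTypical Z = length Z ≡ r × All (λ X → μ X Z ≡ s) Xs

      typical-misses-one : X ∈ Xs → x ∈ X → Y ∈ cs → IsTypical Y → ∑ (miss x) Y ≡ 1
      typical-misses-one X∈ x∈ Y∈ (lY , typ) with partner X∈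
      ... | X₁ , Xs′ , p , X₁∈ with ∈⇒↭ (full∈rest Y∈ lY)
      ...   | _ , q = misses-one (pull p ↭-refl q) (length-Xs X₁∈) (length-Xs X∈) lY (All.lookup typ X₁∈)
          (All.lookup typ X∈) x∈

      -- Within one typical piece x misses a single element, so w and `y₁` coincide; for two
      -- different pieces `missed-independent` applies.
      missed-vertices-independent : X ∈ Xs → x ∈ X → Y ∈ cs → IsTypical Y → Y₁ ∈ cs → IsTypical Y₁ →
                                    w ∈ Y → miss x w ≡ 1 → y₁ ∈ Y₁ → miss x y₁ ≡ 1 →
                                    w ≡ y₁ ⊎ (∀ {a} → vert a ≡ vert y₁ → ¬ a ▷ w)
      missed-vertices-independent {X = X} {x = x} {Y = Y} {Y₁ = Y₁} {w = w} {y₁ = y₁} X∈ x∈ Y∈ typ Y₁∈ typ₁ w∈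
          eqw y₁∈ eqy₁
        with ∈⇒↭ (full∈rest Y∈ (proj₁ typ))
      ... | R , q with ∈-resp-↭ q (full∈rest Y₁∈ (proj₁ typ₁))
      ...   | here refl = inj₁ (∑≡1⇒unique (miss x) Y (typical-misses-one X∈ x∈ Y∈ typ) w∈ y₁∈ eqw eqy₁)
      ...   | there Y₁∈R with ∈⇒↭ Y₁∈R | partner X∈
      ...     | R′ , q′ | X₁ , Xs′ , p , X₁∈ = inj₂ λ {a} va →
        missed-independent {X₁ = X₁} {X = X} {Y = Y} {Y₁ = Y₁} {x = x} {w = w} {y₁ = y₁} {a = a} split₄
          (length-Xs X₁∈) (length-Xs X∈) (proj₁ typ) (proj₁ typ₁)
          (All.lookup (proj₂ typ) X₁∈) (All.lookup (proj₂ typ) X∈) (All.lookup (proj₂ typ₁) X₁∈)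
              (All.lookup (proj₂ typ₁) X∈)
          x∈ w∈ eqw y₁∈ eqy₁ va
        where
        split₄ : cs ↭ X₁ ∷ X ∷ Y ∷ Y₁ ∷ (Xs′ ++ R′)
        split₄ = ↭-trans (pull p ↭-refl (↭-trans q (prep Y q′))) (prep X₁ (prep X (prep Y (shift Y₁ Xs′ R′))))

    -- The largest size below r that occurs often.

    length≤r*between : ∀ Z → length Z ≤ r → length Z ≢ r → length Z ≤ r * 𝟙 (between? 0 Z)
    length≤r*between Z Z≤r Z≢r with 0 <? length Z
    ... | no ≯0  = ≤-trans (≮⇒≥ ≯0) z≤n
    ... | yes 0< = ≤-trans Z≤r (≤-reflexive
        (sym (trans (cong (r *_) (𝟙-yes (between? 0 Z) (0< , ≤∧≢⇒< Z≤r Z≢r))) (*-identityʳ r))))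

    -- Of the maximality of s only the consequence `few` is kept: fewer than r sizes lie strictly
    -- between s and r, and each occurs at most r times.
    record FrequentLength (cs : List (List A)) : Set where
      field
        s        : ℕ
        0<s      : 0 ℕ.< s
        s<r      : s ℕ.< r
        frequent : suc r ≤ ∑ (λ Z → 𝟙 (length Z ≟ s)) cs
        few      : betweens s cs ≤ r * r

    -- Induction on d, the number of sizes strictly between j and r. The recursive call inspects the
    -- larger sizes first, so the size found is the largest frequent one.
    frequentLength : ∀ cs j d → j + suc d ≡ r → FrequentLength cs ⊎ betweens j cs ≤ d * r
    frequentLength cs j zero    eq = inj₂
        (subst (betweens j cs ≤_) (*-zeroʳ (length cs)) (∑-≤ 0 cs λ {Z} _ → ≤-reflexive (𝟙-no (between? j Z)
      λ (j<Z , Z<r) → <⇒≱ Z<r (subst (_≤ length Z) (trans (sym (+-comm j 1)) eq) j<Z))))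
    frequentLength cs j (suc d) eq with frequentLength cs (suc j) d (trans (sym (+-suc j (suc d))) eq)
    ... | inj₁ found = inj₁ found
    ... | inj₂ few with suc r ≤? ∑ (λ Z → 𝟙 (length Z ≟ suc j)) cs
    ...   | yes many = inj₁ record
      { s = suc j ; 0<s = s≤s z≤n ; frequent = many
      ; s<r = subst (suc (suc j) ≤_) eq (≤-trans (≤-reflexive (+-comm 2 j)) (+-monoʳ-≤ j (s≤s (s≤s z≤n))))
      ; few = ≤-trans few (*-monoˡ-≤ r
          (≤-trans (≤-trans (n≤1+n d) (n≤1+n (suc d))) (≤-trans (m≤n+m _ j) (≤-reflexive eq)))) }
    ...   | no ¬many = inj₂ (begin
      betweens j cs                                                            ≤⟨ ∑-mono cs (λ {Z} _ → step Z) ⟩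
      ∑ (λ Z → 𝟙 (length Z ≟ suc j) + 𝟙 (between? (suc j) Z)) cs
        ≡⟨ ∑-+ (λ Z → 𝟙 (length Z ≟ suc j)) (λ Z → 𝟙 (between? (suc j) Z)) cs ⟩
      ∑ (λ Z → 𝟙 (length Z ≟ suc j)) cs + betweens (suc j) cs
        ≤⟨ +-mono-≤ (ℕ.s≤s⁻¹ (≰⇒> ¬many)) few ⟩
      r + d * r                                                                ∎)
      where
      open ≤-Reasoning
      step : ∀ Z → 𝟙 (between? j Z) ≤ 𝟙 (length Z ≟ suc j) + 𝟙 (between? (suc j) Z)
      step Z = 𝟙-≤ (between? j Z) λ (j<Z , Z<r) → by-cases j<Z Z<r (length Z ≟ suc j)
        where
        by-cases : j ℕ.< length Z → length Z ℕ.< r → Dec (length Z ≡ suc j) → 1 ≤ 𝟙 (length Z ≟ suc j) + 𝟙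
            (between? (suc j) Z)
        by-cases j<Z Z<r (yes eq′) = ≤-trans (≤-reflexive (sym (𝟙-yes (length Z ≟ suc j) eq′))) (m≤m+n _ _)
        by-cases j<Z Z<r (no neq)  = ≤-trans
            (≤-reflexive (sym (𝟙-yes (between? (suc j) Z) (≤∧≢⇒< j<Z (neq ∘ sym) , Z<r))))
            (m≤n+m _ (𝟙 (length Z ≟ suc j)))

  -- Sums over vertices and copies of transitive tournaments.

  ∑-tabulate : ∀ {n} {B : Set} (f : B → ℕ) (g : Fin n → B) → ∑ f (tabulate g) ≡ sumFin (f ∘ g)
  ∑-tabulate {zero}  f g = refl
  ∑-tabulate {suc n} f g = cong (f (g zero) +_) (∑-tabulate f (g ∘ suc))

  sumFin-∑ : ∀ {n} (f : Fin n → ℕ) → sumFin f ≡ ∑ f (allFin n)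
  sumFin-∑ f = sym (∑-tabulate f id)

  sumFin-mono : ∀ {n} {f g : Fin n → ℕ} → (∀ i → f i ≤ g i) → sumFin f ≤ sumFin g
  sumFin-mono {f = f} {g} h = subst₂ _≤_ (sym (sumFin-∑ f)) (sym (sumFin-∑ g)) (∑-mono (allFin _) λ {i} _ → h i)

  sumFin-cong : ∀ {n} {f g : Fin n → ℕ} → (∀ i → f i ≡ g i) → sumFin f ≡ sumFin g
  sumFin-cong {f = f} {g} h = trans (sumFin-∑ f) (trans (∑-cong (allFin _) λ {i} _ → h i) (sym (sumFin-∑ g)))

  sumFin-+ : ∀ {n} (f g : Fin n → ℕ) → sumFin (λ i → f i + g i) ≡ sumFin f + sumFin g
  sumFin-+ f g = trans (sumFin-∑ (λ i → f i + g i))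
      (trans (∑-+ f g (allFin _)) (cong₂ _+_ (sym (sumFin-∑ f)) (sym (sumFin-∑ g))))

  boolToℕ≤1 : ∀ b → boolToℕ b ≤ 1
  boolToℕ≤1 true  = ≤-refl
  boolToℕ≤1 false = z≤n

  sumFin-const : ∀ n k → sumFin {n} (λ _ → k) ≡ n * k
  sumFin-const zero    k = refl
  sumFin-const (suc n) k = cong (k +_) (sumFin-const n k)

  sumFin-𝟙≟ : ∀ {n} (i : Fin n) → sumFin (λ j → 𝟙 (i Fin.≟ j)) ≡ 1
  sumFin-𝟙≟ {suc n} zero    = cong suc (trans (sumFin-const n 0) (*-zeroʳ n))
  sumFin-𝟙≟ {suc n} (suc i) = sumFin-𝟙≟ i

  sumFin-𝟙≟′ : ∀ {n} (i : Fin n) → sumFin (λ j → 𝟙 (j Fin.≟ i)) ≡ 1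
  sumFin-𝟙≟′ {suc n} zero    = cong suc (trans (sumFin-const n 0) (*-zeroʳ n))
  sumFin-𝟙≟′ {suc n} (suc i) = sumFin-𝟙≟′ i

  AllPairs-lookup : ∀ {B : Set} {R : B → B → Set} {xs} → AllPairs R xs → ∀ {i j} → i Fin.< j → R (lookup xs i)
      (lookup xs j)
  AllPairs-lookup (px ∷ _)  {zero}  {suc j} _         = All.lookup px (∈-lookup j)
  AllPairs-lookup (_ ∷ ap)  {suc i} {suc j} (s≤s i<j) = AllPairs-lookup ap i<j

  enumerate : ∀ {B : Set} {r} (L : List B) → length L ≡ r → Fin r → B
  enumerate L refl = lookup L

  enumerate∈ : ∀ {B : Set} {r} (L : List B) (len : length L ≡ r) i → enumerate L len i ∈ L
  enumerate∈ L refl i = ∈-lookup i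

  enumerate-onto : ∀ {B : Set} {r} (L : List B) (len : length L ≡ r) {x} → x ∈ L → ∃ λ i → enumerate L len i ≡ x
  enumerate-onto L refl x∈ = Any.index x∈ , sym (lookup-index x∈)

  module _ {n : ℕ} (G : Digraph n) where

    Edge : Fin n → Fin n → Set
    Edge u v = adj G u v ≡ true

    no-loop : ∀ {u v} → u ≡ v → ¬ Edge u v
    no-loop {u} refl e with () ← trans (sym e) (loopless G u)

    -- Injectivity holds because equal entries in different positions would give a loop.
    trCopy : ∀ {r} (L : List (Fin n)) (len : length L ≡ r) → AllPairs Edge L → TrCopy G r (enumerate L len)
    trCopy L refl ap = injective , λ i j → AllPairs-lookup ap
      where
      injective : ∀ {i j} → lookup L i ≡ lookup L j → i ≡ j
      injective {i} {j} eq with Fin.<-cmp i j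
      ... | tri< i<j _ _ = ⊥-elim (no-loop eq (AllPairs-lookup ap i<j))
      ... | tri≈ _ i≡j _ = i≡j
      ... | tri> _ _ j<i = ⊥-elim (no-loop (sym eq) (AllPairs-lookup ap j<i))

  -- Digraphs

  module Signed {n : ℕ} (G : Digraph n) (Hi⁺ Hi⁻ : Fin n → Set) (r : ℕ) where

    -- A vertex together with a choice of the neighbourhood in which it is used:
    -- the outneighbourhood (inj₁) or the inneighbourhood (inj₂).
    A : Set
    A = Σ (Fin n) λ v → Hi⁺ v ⊎ Hi⁻ v

    sees : A → Fin n → Bool
    sees (v , inj₁ _) w = adj G v w
    sees (v , inj₂ _) w = adj G w v

    sees-irrefl : ∀ a → sees a (proj₁ a) ≡ false
    sees-irrefl (v , inj₁ _) = loopless G v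
    sees-irrefl (v , inj₂ _) = loopless G v

    open Tiling {A} {Fin n} proj₁ sees r

    -- With f the indicator of a vertex, this says that the vertex occurs exactly once.
    Partition : List (List A) → Set
    Partition cs = ∀ f → total f cs ≡ sumFin f

    -- A vertex used with its outneighbourhood is put before all later ones, a vertex used with its
    -- inneighbourhood after them. So seeing all later elements becomes a transitive order.
    arrange : List A → List (Fin n)
    arrange []                = []
    arrange ((v , inj₁ _) ∷ X) = v ∷ arrange X
    arrange ((v , inj₂ _) ∷ X) = arrange X ++ [ v ]

    arrange-↭ : ∀ X → arrange X ↭ map proj₁ X
    arrange-↭ []                 = ↭-refl
    arrange-↭ ((v , inj₁ _) ∷ X) = prep v (arrange-↭ X)
    arrange-↭ ((v , inj₂ _) ∷ X) = ↭-trans (++-comm (arrange X) [ v ]) (prep v (arrange-↭ X))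

    arrange-edges : ∀ X → AllPairs _▷_ X → AllPairs (Edge G) (arrange X)
    arrange-edges []                 []        = []
    arrange-edges ((v , inj₁ _) ∷ X) (px ∷ ap) = All-resp-↭ (↭-sym (arrange-↭ X)) (All.map⁺ px) ∷ arrange-edges X ap
    arrange-edges ((v , inj₂ _) ∷ X) (px ∷ ap) = AllPairs.++⁺ (arrange-edges X ap) ([] ∷ [])
      (All.map (_∷ []) (All-resp-↭ (↭-sym (arrange-↭ X)) (All.map⁺ px)))

    ordering : ∀ {X} → Good X → List (Fin n)
    ordering (X′ , _) = arrange X′

    ordering-↭ : ∀ {X} (g : Good X) → ordering g ↭ map proj₁ X
    ordering-↭ (X′ , p , _) = ↭-trans (arrange-↭ X′) (map⁺ proj₁ p)

    length-ordering : ∀ {X} (g : Good X) → length (ordering g) ≡ length X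
    length-ordering {X} g = trans (↭-length (ordering-↭ g)) (length-map proj₁ X)

    -- Packings from optimal partitions.

    at : Fin n → Fin n → ℕ
    at v w = 𝟙 (w Fin.≟ v)

    vertex-counts : ∀ (cs : List (List A)) → sumFin (λ v → total (at v) cs) ≡ ∑ (length {A = A}) cs
    vertex-counts cs = begin
      sumFin (λ v → total (at v) cs)                                       ≡⟨ sumFin-∑ (λ v → total (at v) cs) ⟩
      ∑ (λ v → ∑ (λ Z → ∑ (λ z → at v (proj₁ z)) Z) cs) (allFin n)
        ≡⟨ ∑-swap (λ v Z → ∑ (λ z → at v (proj₁ z)) Z) (allFin n) cs ⟩
      ∑ (λ Z → ∑ (λ v → ∑ (λ z → at v (proj₁ z)) Z) (allFin n)) cs         ≡⟨ ∑-cong cs (λ {Z} _ → vertex-count Z) ⟩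
      ∑ (length {A = A}) cs                                                ∎
      where
      open ≡-Reasoning
      vertex-count : ∀ Z → ∑ (λ v → ∑ (λ z → at v (proj₁ z)) Z) (allFin n) ≡ length Z
      vertex-count Z = begin
        ∑ (λ v → ∑ (λ z → at v (proj₁ z)) Z) (allFin n)   ≡⟨ ∑-swap (λ v z → at v (proj₁ z)) (allFin n) Z ⟩
        ∑ (λ z → ∑ (λ v → at v (proj₁ z)) (allFin n)) Z
          ≡⟨ ∑-cong Z (λ {z} _ → trans (sym (sumFin-∑ (λ v → 𝟙 (proj₁ z Fin.≟ v)))) (sumFin-𝟙≟ (proj₁ z))) ⟩
        ∑ (λ _ → 1) Z                                     ≡⟨ ∑-const 1 Z ⟩
        length Z * 1                                      ≡⟨ *-identityʳ _ ⟩
        length Z                                          ∎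

    at-∈ : ∀ {v} {Z : List A} → v ∈ map proj₁ Z → 1 ≤ ∑ (at v ∘ proj₁) Z
    at-∈ {v} v∈ with ∈-map⁻ proj₁ v∈
    ... | z , z∈ , refl = ≤-trans (≤-reflexive (sym (𝟙-yes (v Fin.≟ v) refl))) (∑-∈ (at v ∘ proj₁) z∈)

    total≢0⇒∈ : ∀ {v} cs → total (at v) cs ≢ 0 → ∃₂ λ Z z → Z ∈ cs × z ∈ Z × proj₁ z ≡ v
    total≢0⇒∈ {v} cs h with ∑≢0⇒∃ (∑ (at v ∘ proj₁)) cs h
    ... | Z , Z∈ , h′ with ∑≢0⇒∃ (at v ∘ proj₁) Z h′
    ...   | z , z∈ , h″ with proj₁ z Fin.≟ v
    ...     | yes eq = Z , z , Z∈ , z∈ , eq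
    ...     | no  _  = ⊥-elim (h″ refl)

    module _ {fs : List (List A)} (full : All (λ X → Good X × length X ≡ r) fs)
        (once : ∀ v → total (at v) fs ≤ 1) where

      good : ∀ c → Good (lookup fs c)
      good c = proj₁ (All.lookup full (∈-lookup c))

      len : ∀ c → length (ordering (good c)) ≡ r
      len c = trans (length-ordering (good c)) (proj₂ (All.lookup full (∈-lookup c)))

      packing : TrPacking G r
      packing = record
        { k        = length fs
        ; copy     = λ c → enumerate (ordering (good c)) (len c)
        ; isCopy   = λ c → trCopy G (ordering (good c)) (len c)
            (arrange-edges (proj₁ (good c)) (proj₂ (proj₂ (good c))))
        -- A vertex shared by the copies c and c′ makes both of their terms positive in a sum that
        -- `once` bounds by 1.
        ; disjoint = λ c c′ i i′ eq → ∑≤1⇒≡ (∑ (at (enumerate (ordering (good c)) (len c) i) ∘ proj₁)) fs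
            (once _) c c′ (visits c i) (subst (λ v → 1 ≤ ∑ (at v ∘ proj₁) (lookup fs c′)) (sym eq) (visits c′ i′))
        }
        where
        visits : ∀ c i → 1 ≤ ∑ (at (enumerate (ordering (good c)) (len c) i) ∘ proj₁) (lookup fs c)
        visits c i = at-∈ (∈-resp-↭ (ordering-↭ (good c)) (enumerate∈ (ordering (good c)) (len c) i))

      packing-covers : ∀ v → total (at v) fs ≢ 0 → Covered packing v
      packing-covers v h with total≢0⇒∈ fs h
      ... | Z , z , Z∈ , z∈ , refl = c , enumerate-onto (ordering (good c)) (len c)
              (∈-resp-↭ (↭-sym (ordering-↭ (good c))) (∈-map⁺ proj₁ (subst (z ∈_) (lookup-index Z∈) z∈)))
        where
        c : Fin (length fs)
        c = Any.index Z∈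

    boolToℕ-does : {P : Set} (p? : Dec P) → boolToℕ (does p?) ≡ 𝟙 p?
    boolToℕ-does p? with does p?
    ... | true  = refl
    ... | false = refl

    -- The full pieces are the copies. Any other vertex lies in a nonempty piece with fewer than r
    -- elements, and `betweens 0 cs` counts these pieces.
    optimal⇒packing : ∀ {cs} → Optimal cs → Partition cs → Σ (TrPacking G r) λ P → CoversAllBut P
        (r * betweens 0 cs)
    optimal⇒packing {cs} opt part with separate (λ Z → length Z ≟ r) cs
    ... | fs , os , p , lfs , los = packing full once , (λ v → does (total (at v) fs ≟ 0)) , few , covered
      where
      totals : ∀ v → total (at v) fs + total (at v) os ≡ 1
      totals v = trans (sym (trans (∑-↭ _ p) (∑-++ _ fs os))) (trans (part (at v)) (sumFin-𝟙≟′ v))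
      full : All (λ X → Good X × length X ≡ r) fs
      full = All.zip (All.map proj₁ (All.++⁻ˡ fs (All-resp-↭ p (Optimal.pieces opt))) , lfs)
      once : ∀ v → total (at v) fs ≤ 1
      once v = subst (total (at v) fs ≤_) (totals v) (m≤m+n _ _)
      covered : ∀ v → does (total (at v) fs ≟ 0) ≡ false → Covered (packing full once) v
      covered v eq = packing-covers full once v λ eq₀ → contra (trans (sym (dec-true (total (at v) fs ≟ 0) eq₀)) eq)
        where
        contra : true ≢ false
        contra ()
      open ≤-Reasoning
      uncovered : ∀ v → boolToℕ (does (total (at v) fs ≟ 0)) ≤ total (at v) os
      uncovered v = ≤-trans (≤-reflexive (boolToℕ-does (total (at v) fs ≟ 0))) (𝟙-≤ (total (at v) fs ≟ 0) λ eq₀ →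
        ≤-reflexive (trans (sym (totals v)) (cong (_+ total (at v) os) eq₀)))
      few : count (λ v → does (total (at v) fs ≟ 0)) ≤ r * betweens 0 cs
      few = begin
        count (λ v → does (total (at v) fs ≟ 0))   ≤⟨ sumFin-mono uncovered ⟩
        sumFin (λ v → total (at v) os)               ≡⟨ vertex-counts os ⟩
        ∑ (length {A = A}) os
          ≤⟨ ∑-mono os (λ {Z} Z∈ → length≤r*between Z
              (proj₂ (All.lookup (All.++⁻ʳ fs (All-resp-↭ p (Optimal.pieces opt))) Z∈)) (All.lookup los Z∈)) ⟩
        ∑ (λ Z → r * 𝟙 (between? 0 Z)) os            ≡⟨ ∑-* r (λ Z → 𝟙 (between? 0 Z)) os ⟩
        r * betweens 0 os
          ≤⟨ *-monoʳ-≤ r (≤-trans (m≤n+m _ (betweens 0 fs)) (≤-reflexive (sym (trans (∑-↭ _ p) (∑-++ _ fs os))))) ⟩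
        r * betweens 0 cs                            ∎

    order≡n : ∀ cs → Partition cs → ∑ (length {A = A}) cs ≡ n
    order≡n cs part = begin
      ∑ (length {A = A}) cs   ≡⟨ ∑-cong cs (λ {Z} _ → sym (trans (∑-const 1 Z) (*-identityʳ _))) ⟩
      total (λ _ → 1) cs      ≡⟨ part (λ _ → 1) ⟩
      sumFin {n} (λ _ → 1)    ≡⟨ sumFin-const n 1 ⟩
      n * 1                   ≡⟨ *-identityʳ n ⟩
      n                       ∎
      where open ≡-Reasoning

    -- The sparse set of missed vertices.

    module SparseSet
      (Hi⁺? : ∀ v → Dec (Hi⁺ v)) (Hi⁻? : ∀ v → Dec (Hi⁻ v))
      (low-no-edge : ∀ u v → ¬ Hi⁺ u → ¬ Hi⁻ v → ¬ Edge G u v)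
      {cs rest Xs : List (List A)} (opt : Optimal cs) (part : Partition cs) {s : ℕ} (s<r : s ℕ.< r)
      (split : cs ↭ Xs ++ rest) (lXs : length Xs ≡ suc r) (lens : All (λ X → length X ≡ s) Xs)
      {X : List A} {x : A} (X∈ : X ∈ Xs) (x∈ : x ∈ X) where

      open Counting sees-irrefl opt s<r split lXs lens

      -- Positive exactly on the vertices of nontypical pieces.
      badAt : Fin n → ℕ
      badAt v = ∑ (λ Z → if does (typical? Z) then 0 else ∑ (at v ∘ proj₁) Z) cs

      -- The vertices missed by x, together with all vertices of nontypical pieces. The latter are
      -- few, and including them guarantees the size n/r.
      S : VSet n
      S v = not (sees x v) ∨ does (1 ≤? badAt v)

      badAt-total : sumFin badAt ≡ ∑ bad cs
      badAt-total = begin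
        sumFin badAt                                                                         ≡⟨ sumFin-∑ badAt ⟩
        ∑ badAt (allFin n)
          ≡⟨ ∑-swap (λ v Z → if does (typical? Z) then 0 else ∑ (at v ∘ proj₁) Z) (allFin n) cs ⟩
        ∑ (λ Z → ∑ (λ v → if does (typical? Z) then 0 else ∑ (at v ∘ proj₁) Z) (allFin n)) cs
          ≡⟨ ∑-cong cs (λ {Z} _ → piece Z (does (typical? Z))) ⟩
        ∑ bad cs                                                                             ∎
        where
        open ≡-Reasoning
        piece : ∀ Z b → ∑ (λ v → if b then 0 else ∑ (at v ∘ proj₁) Z) (allFin n) ≡ (if b then 0 else length Z)
        piece Z true  = trans (∑-const 0 (allFin n)) (*-zeroʳ (length (allFin n)))
        piece Z false = begin
          ∑ (λ v → ∑ (at v ∘ proj₁) Z) (allFin n)     ≡⟨ sumFin-∑ (λ v → ∑ (at v ∘ proj₁) Z) ⟨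
          sumFin (λ v → ∑ (at v ∘ proj₁) Z)
            ≡⟨ sumFin-cong (λ v → sym (+-identityʳ (∑ (at v ∘ proj₁) Z))) ⟩
          sumFin (λ v → total (at v) (Z ∷ []))        ≡⟨ vertex-counts (Z ∷ []) ⟩
          length Z + 0                                ≡⟨ +-identityʳ _ ⟩
          length Z                                    ∎

      nontypical⇒badAt : ∀ {Z z} → Z ∈ cs → z ∈ Z → ¬ IsTypical Z → 1 ≤ badAt (proj₁ z)
      nontypical⇒badAt {Z} {z} Z∈ z∈ ¬typ = ≤-trans (at-∈ (∈-map⁺ proj₁ z∈)) (≤-trans
        (≤-reflexive (cong (λ b → if b then 0 else ∑ (at (proj₁ z) ∘ proj₁) Z) (sym (dec-false (typical? Z) ¬typ))))
        (∑-∈ (λ Z → if does (typical? Z) then 0 else ∑ (at (proj₁ z) ∘ proj₁) Z) Z∈))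

      located : ∀ v → ∃₂ λ Z z → Z ∈ cs × z ∈ Z × proj₁ z ≡ v
      located v = total≢0⇒∈ cs λ eq → 1+n≢0 (trans (sym (trans (part (at v)) (sumFin-𝟙≟′ v))) eq)

      -- A typical piece contains one missed vertex among its r elements, and a nontypical piece
      -- lies in S entirely.
      S-large : n ≤ r * count S
      S-large = begin
        n                                  ≡⟨ order≡n cs part ⟨
        ∑ (length {A = A}) cs              ≤⟨ ∑-mono cs (λ {Z} Z∈ → piece Z Z∈ (typical? Z)) ⟩
        ∑ (λ Z → r * ∑ (inS ∘ proj₁) Z) cs ≡⟨ ∑-* r (λ Z → ∑ (inS ∘ proj₁) Z) cs ⟩
        r * total inS cs                   ≡⟨ cong (r *_) (part inS) ⟩
        r * count S                        ∎
        where
        open ≤-Reasoning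
        inS : Fin n → ℕ
        inS v = boolToℕ (S v)
        miss≤inS : ∀ z → miss x z ≤ inS (proj₁ z)
        miss≤inS z with sees x (proj₁ z)
        ... | true  = z≤n
        ... | false = ≤-refl
        bad⇒inS : ∀ v → 1 ≤ badAt v → 1 ≤ inS v
        bad⇒inS v h rewrite dec-true (1 ≤? badAt v) h with sees x v
        ... | true  = ≤-refl
        ... | false = ≤-refl
        piece : ∀ Z → Z ∈ cs → Dec (IsTypical Z) → length Z ≤ r * ∑ (inS ∘ proj₁) Z
        piece Z Z∈ (yes typ) = begin
          length Z                ≡⟨ proj₁ typ ⟩
          r                       ≡⟨ *-identityʳ r ⟨
          r * 1                   ≡⟨ cong (r *_) (typical-misses-one X∈ x∈ Z∈ typ) ⟨
          r * ∑ (miss x) Z        ≤⟨ *-monoʳ-≤ r (∑-mono Z λ {z} _ → miss≤inS z) ⟩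
          r * ∑ (inS ∘ proj₁) Z   ∎
        piece Z Z∈ (no ¬typ) = begin
          length Z                ≡⟨ *-identityʳ _ ⟨
          length Z * 1            ≤⟨ ∑-≥ 1 Z (λ {z} z∈ → bad⇒inS (proj₁ z) (nontypical⇒badAt Z∈ z∈ ¬typ)) ⟩
          ∑ (inS ∘ proj₁) Z       ≡⟨ *-identityˡ _ ⟨
          1 * ∑ (inS ∘ proj₁) Z   ≤⟨ *-monoˡ-≤ (∑ (inS ∘ proj₁) Z) (≤-trans (s≤s z≤n) s<r) ⟩
          r * ∑ (inS ∘ proj₁) Z   ∎

      -- Both u and v are missed by x in typical pieces. If u has a large outneighbourhood, the edge
      -- means that u, used with it, sees v; if v has a large inneighbourhood, v sees u. Both
      -- contradict `missed-vertices-independent`, and without either the edge is excluded by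
      -- `low-no-edge`.
      independent : ∀ u v → S u ≡ true → S v ≡ true → badAt u ≡ 0 → badAt v ≡ 0 → ¬ Edge G u v
      independent u v Su Sv bu bv e with located u | located v
      ... | Zu , zu , Zu∈ , zu∈ , refl | Zv , zv , Zv∈ , zv∈ , refl = by-degree (Hi⁺? u) (Hi⁻? v)
        where
        missed : ∀ z → S (proj₁ z) ≡ true → badAt (proj₁ z) ≡ 0 → miss x z ≡ 1
        missed z Sz bz rewrite dec-false (1 ≤? badAt (proj₁ z)) (λ h → n≮0 (subst (1 ≤_) bz h)) with sees x
            (proj₁ z)
        ... | false = refl
        typical : ∀ {Z z} → Z ∈ cs → z ∈ Z → badAt (proj₁ z) ≡ 0 → IsTypical Z
        typical {Z} Z∈ z∈ bz with typical? Z
        ... | yes typ = typ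
        ... | no ¬typ = ⊥-elim (n≮0 (subst (1 ≤_) bz (nontypical⇒badAt Z∈ z∈ ¬typ)))
        tu : IsTypical Zu
        tu = typical Zu∈ zu∈ bu
        tv : IsTypical Zv
        tv = typical Zv∈ zv∈ bv
        mu : miss x zu ≡ 1
        mu = missed zu Su bu
        mv : miss x zv ≡ 1
        mv = missed zv Sv bv
        by-degree : Dec (Hi⁺ u) → Dec (Hi⁻ v) → ⊥
        by-degree (yes h) _ with missed-vertices-independent X∈ x∈ Zv∈ tv Zu∈ tu zv∈ mv zu∈ mu
        ... | inj₁ eq   = no-loop G (cong proj₁ (sym eq)) e
        ... | inj₂ none = none {u , inj₁ h} refl e
        by-degree (no _) (yes h) with missed-vertices-independent X∈ x∈ Zu∈ tu Zv∈ tv zu∈ mu zv∈ mv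
        ... | inj₁ eq   = no-loop G (cong proj₁ eq) e
        ... | inj₂ none = none {v , inj₂ h} refl e
        by-degree (no ¬h) (no ¬h′) = low-no-edge u v ¬h ¬h′ e

      -- By `independent` each edge inside S has an end u with `badAt u` positive, and there are at
      -- most n choices for the other end.
      S-edges : edgesIn G S ≤ 2 * (n * ∑ bad cs)
      S-edges = begin
        edgesIn G S
          ≤⟨ sumFin-mono (λ u → sumFin-mono (λ v → edge u v (badAt u) (badAt v) refl refl)) ⟩
        sumFin (λ u → sumFin (λ v → badAt u + badAt v))
          ≡⟨ sumFin-cong {n} (λ u → trans (sumFin-+ (λ _ → badAt u) badAt)
              (cong (_+ sumFin badAt) (sumFin-const n (badAt u)))) ⟩
        sumFin (λ u → n * badAt u + sumFin badAt)
          ≡⟨ sumFin-+ {n} (λ u → n * badAt u) (λ _ → sumFin badAt) ⟩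
        sumFin (λ u → n * badAt u) + sumFin {n} (λ _ → sumFin badAt)
          ≡⟨ cong₂ _+_ (trans (sumFin-∑ (λ u → n * badAt u))
              (trans (∑-* n badAt (allFin n)) (cong (n *_) (sym (sumFin-∑ badAt)))))
              (sumFin-const n (sumFin badAt)) ⟩
        n * sumFin badAt + n * sumFin badAt                     ≡⟨ cong (λ b → n * b + n * b) badAt-total ⟩
        n * ∑ bad cs + n * ∑ bad cs                             ≡⟨ cong (n * ∑ bad cs +_) (+-identityʳ _) ⟨
        2 * (n * ∑ bad cs)                                      ∎
        where
        open ≤-Reasoning
        edge : ∀ u v b c → badAt u ≡ b → badAt v ≡ c → boolToℕ (S u ∧ S v ∧ adj G u v) ≤ b + c
        edge u v (suc b) c       eqb eqc = ≤-trans (boolToℕ≤1 (S u ∧ S v ∧ adj G u v)) (s≤s z≤n)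
        edge u v zero    (suc c) eqb eqc = ≤-trans (boolToℕ≤1 (S u ∧ S v ∧ adj G u v)) (s≤s z≤n)
        edge u v zero    zero    eqb eqc with S u in eqS | S v in eqS′ | adj G u v in e
        ... | true  | true  | true  = ⊥-elim (independent u v eqS eqS′ eqb eqc e)
        ... | true  | true  | false = z≤n
        ... | true  | false | _     = z≤n
        ... | false | _     | _     = z≤n

      S-sparse : ∀ q → (∀ a → q * r * sumFin (λ v → boolToℕ (not (sees a v))) ≤ (q + r) * n) → betweens s cs ≤
          r * r →
                 q * edgesIn G S ≤ 2 * (n * (suc r * s * (r * n) + q * (slack * (r * r))))
      S-sparse q deg few = begin
        q * edgesIn G S                                              ≤⟨ *-monoʳ-≤ q S-edges ⟩
        q * (2 * (n * ∑ bad cs))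
          ≡⟨ solve 3 (λ q n b → q :* (con 2 :* (n :* b)) := con 2 :* (n :* (q :* b))) refl q n (∑ bad cs) ⟩
        2 * (n * (q * ∑ bad cs))
          ≤⟨ *-monoʳ-≤ 2 (*-monoʳ-≤ n (bad-bound q deg′ (r * r) few)) ⟩
        2 * (n * (suc r * s * (r * order) + q * (slack * (r * r))))
          ≡⟨ cong (λ m → 2 * (n * (suc r * s * (r * m) + q * (slack * (r * r))))) (order≡n cs part) ⟩
        2 * (n * (suc r * s * (r * n) + q * (slack * (r * r))))      ∎
        where
        open ≤-Reasoning
        open +-*-Solver
        missed : ∀ a → missTotal a ≡ sumFin (λ v → boolToℕ (not (sees a v)))
        missed a = trans (part (λ v → if sees a v then 0 else 1)) (sumFin-cong λ v → if-not (sees a v))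
          where
          if-not : ∀ b → (if b then 0 else 1) ≡ boolToℕ (not b)
          if-not true  = refl
          if-not false = refl
        deg′ : ∀ a → q * r * missTotal a ≤ (q + r) * order
        deg′ a = subst₂ (λ m k → q * r * m ≤ (q + r) * k) (sym (missed a)) (sym (order≡n cs part)) (deg a)

  -- Existence of an optimal partition and the two alternatives.

  ∑-map : ∀ {B C : Set} (f : C → ℕ) (g : B → C) xs → ∑ f (map g xs) ≡ ∑ (λ x → f (g x)) xs
  ∑-map f g []       = refl
  ∑-map f g (x ∷ xs) = cong (f (g x) +_) (∑-map f g xs)

  nonempty : ∀ {B : Set} (xs : List B) → 0 ℕ.< length xs → ∃ λ x → x ∈ xs
  nonempty (x ∷ xs) _ = x , here refl

  coversAllBut-mono : ∀ {n r} {G : Digraph n} {P : TrPacking G r} {k l} → k ≤ l → CoversAllBut P k →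
      CoversAllBut P l
  coversAllBut-mono k≤l (U , few , covered) = U , ≤-trans few k≤l , covered

  -- The value of `slack` times the bound r · r on the number of pieces of size strictly between s
  -- and r.
  error-const : ℕ → ℕ
  error-const r = (suc r * r * r + r) * (r * r)

  module Dichotomy {n : ℕ} (G : Digraph n) (Hi⁺ Hi⁻ : Fin n → Set) (r : ℕ) (0<r : 0 ℕ.< r)
    (Hi⁺? : ∀ v → Dec (Hi⁺ v)) (Hi⁻? : ∀ v → Dec (Hi⁻ v)) (hi : ∀ v → Hi⁺ v ⊎ Hi⁻ v)
    (low-no-edge : ∀ u v → ¬ Hi⁺ u → ¬ Hi⁻ v → ¬ Edge G u v) where

    open Signed G Hi⁺ Hi⁻ r
    open Tiling {A} {Fin n} proj₁ sees r

    Φ≤ : ∀ cs → All Piece cs → Partition cs → Φ cs ≤ r * n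
    Φ≤ cs ps part = begin
      Φ cs
        ≤⟨ ∑-mono cs (λ {Z} Z∈ → *-monoˡ-≤ (length Z) (proj₂ (All.lookup ps Z∈))) ⟩
      ∑ (λ Z → r * length Z) cs            ≡⟨ ∑-* r (length {A = A}) cs ⟩
      r * ∑ (length {A = A}) cs            ≡⟨ cong (r *_) (order≡n cs part) ⟩
      r * n                                ∎
      where open ≤-Reasoning

    -- A partition that is not optimal can be exchanged for one of larger potential, and `Φ≤` limits
    -- how often: `fuel` bounds the room left below r · n. Optimality is reached only up to double
    -- negation, which is removed once the conclusion is known to be decidable.
    climb : ∀ fuel cs → All Piece cs → Partition cs → r * n ≤ Φ cs + fuel → ¬ ¬ ∃ λ cs → Optimal cs × Partition cs
    climb fuel cs ps part bound k = k
        (cs , record { pieces = ps ; max = λ {cs′} ps′ same → ≮⇒≥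
        (better fuel cs′ ps′ (λ f → trans (same f) (part f)) bound) } , part)
      where
      better : ∀ fuel cs′ → All Piece cs′ → Partition cs′ → r * n ≤ Φ cs + fuel → ¬ Φ cs ℕ.< Φ cs′
      better zero       cs′ ps′ part′ bound lt = <⇒≱ lt
          (≤-trans (Φ≤ cs′ ps′ part′) (subst (r * n ≤_) (+-identityʳ _) bound))
      better (suc fuel) cs′ ps′ part′ bound lt = climb fuel cs′ ps′ part′
        (≤-trans bound (≤-trans (≤-reflexive (+-suc (Φ cs) fuel)) (+-monoˡ-≤ fuel lt))) k

    optimal-exists : ¬ ¬ ∃ λ cs → Optimal cs × Partition cs
    optimal-exists = climb (r * n) singletons
      (All.map⁺ (All.tabulate λ _ → good-[ _ ] , 0<r))
      (λ f → trans (∑-map (∑ (f ∘ proj₁)) (λ v → [ v , hi v ]) (allFin n))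
          (trans (∑-cong (allFin n) λ {v} _ → +-identityʳ (f v)) (sym (sumFin-∑ f))))
      (m≤n+m _ (Φ singletons))
      where
      singletons : List (List A)
      singletons = map (λ v → [ v , hi v ]) (allFin n)

    -- The bound of `S-sparse` with s replaced by r, so that it does not depend on the size that is
    -- found.
    Sparse : ℕ → VSet n → Set
    Sparse q S = n ≤ r * count S × q * edgesIn G S ≤ 2 * (n * (suc r * r * (r * n) + q * error-const r))

    dichotomy : ∀ q → (∀ a → q * r * sumFin (λ v → boolToℕ (not (sees a v))) ≤ (q + r) * n) →
                ¬ ¬ ((Σ (TrPacking G r) λ P → CoversAllBut P (r * (r * r))) ⊎ ∃ (Sparse q))
    dichotomy q deg k = optimal-exists λ (cs , opt , part) → k (decompose cs opt part)
      where
      decompose : ∀ cs → Optimal cs → Partition cs → (Σ (TrPacking G r) λ P → CoversAllBut P (r * (r * r))) ⊎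
          ∃ (Sparse q)
      -- Starting from j = 0, all sizes 1, ..., r - 1 are searched; if none is frequent, the full
      -- pieces leave few vertices uncovered.
      decompose cs opt part with frequentLength cs 0 (ℕ.pred r) (suc-pred r {{ℕ.>-nonZero 0<r}})
      ... | inj₂ few = inj₁ (let P , covers = optimal⇒packing opt part in P , coversAllBut-mono {P = P}
          (*-monoʳ-≤ r (≤-trans few (*-monoˡ-≤ r (pred[n]≤n {r})))) covers)
      ... | inj₁ F with extract (λ Z → length Z ≟ FrequentLength.s F) (suc r) cs (FrequentLength.frequent F)
      ...   | Xs , rest , split , lXs , lens with nonempty Xs (subst (0 ℕ.<_) (sym lXs) (s≤s z≤n))
      ...     | X , X∈ with nonempty X (subst (0 ℕ.<_) (sym (All.lookup lens X∈)) (FrequentLength.0<s F))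
      ...       | x , x∈ = inj₂ (SS.S , SS.S-large , ≤-trans (SS.S-sparse q deg few)
                    (*-monoʳ-≤ 2 (*-monoʳ-≤ n (+-monoˡ-≤ (q * error-const r)
                        (*-monoˡ-≤ (r * n) (*-monoʳ-≤ (suc r) (<⇒≤ s<r)))))))
        where
        open FrequentLength F
        module SS = SparseSet Hi⁺? Hi⁻? low-no-edge opt part s<r split lXs lens X∈ x∈

  -- Exhaustive search

  -- A search through all elements up to _~_, for the predicates that respect _~_.
  Searchable : {B : Set} → (B → B → Set) → Set₁
  Searchable {B} _~_ = ∀ {P : B → Set} → (∀ {a b} → a ~ b → P a → P b) → (∀ b → Dec (P b)) → Dec (∃ P)

  search-Bool : Searchable {Bool} _≡_
  search-Bool _ P? with P? true | P? false
  ... | yes p | _     = yes (true , p)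
  ... | no _  | yes p = yes (false , p)
  ... | no ¬p | no ¬q = no λ { (true , p) → ¬p p ; (false , q) → ¬q q }

  search-Fin : ∀ {n} → Searchable {Fin n} _≡_
  search-Fin _ P? = Fin.any? P?

  private
    infixr 5 _◂_
    _◂_ : ∀ {k} {B : Set} → B → (Fin k → B) → Fin (suc k) → B
    (b ◂ f) zero    = b
    (b ◂ f) (suc i) = f i

  -- A function on `Fin (suc k)` agrees with its first value put before the rest only pointwise;
  -- hence the restriction to predicates that respect the relation.
  search-→ : ∀ {k} {B : Set} {_~_ : B → B → Set} → (∀ {b} → b ~ b) → Searchable _~_ →
             Searchable {Fin k → B} (λ f g → ∀ i → f i ~ g i)
  search-→ {zero} ~-refl search {P} resp P? with P? (λ ())
  ... | yes p = yes ((λ ()) , p)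
  ... | no ¬p = no λ (f , p) → ¬p (resp (λ ()) p)
  search-→ {suc k} {B} {_~_} ~-refl search {P} resp P? =
    map′ (λ (b , f , p) → b ◂ f , p)
         (λ (f , p) → f zero , f ∘ suc , resp (λ { zero → ~-refl ; (suc i) → ~-refl }) p)
         (search {P = λ b → ∃ λ f → P (b ◂ f)}
           (λ b~b′ (f , p) → f , resp (λ { zero → b~b′ ; (suc i) → ~-refl }) p)
           (λ b → search-→ {k} ~-refl search {P = λ f → P (b ◂ f)}
             (λ f~g p → resp (λ { zero → ~-refl ; (suc i) → f~g i }) p) (λ f → P? (b ◂ f))))

  count-cong : ∀ {n} {f g : Fin n → Bool} → (∀ i → f i ≡ g i) → count f ≡ count g
  count-cong h = sumFin-cong λ i → cong boolToℕ (h i)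

  edgesIn-cong : ∀ {n} (G : Digraph n) {S T : VSet n} → (∀ v → S v ≡ T v) → edgesIn G S ≡ edgesIn G T
  edgesIn-cong G h = sumFin-cong λ u → count-cong λ v → cong₂ (λ a b → a ∧ b ∧ adj G u v) (h u) (h v)

  module PackingSearch {n : ℕ} (G : Digraph n) (r : ℕ) (ℓ : ℕ) where

    IsPacking : ∀ k → (Fin k → Fin r → Fin n) → VSet n → Set
    IsPacking k copy U =
      (∀ c → TrCopy G r (copy c)) × (∀ c c′ i i′ → copy c i ≡ copy c′ i′ → c ≡ c′) ×
      count U ≤ ℓ × (∀ x → U x ≡ false → ∃ λ c → ∃ λ i → copy c i ≡ x)

    isPacking? : ∀ k copy U → Dec (IsPacking k copy U)
    isPacking? k copy U =
      Fin.all? (λ c → trCopy? (copy c)) ×-dec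
      Fin.all? (λ c → Fin.all? λ c′ → Fin.all? λ i → Fin.all? λ i′ → (copy c i Fin.≟ copy c′ i′) →-dec
          (c Fin.≟ c′)) ×-dec
      (count U ≤? ℓ) ×-dec
      Fin.all? (λ x → (U x Bool.≟ false) →-dec Fin.any? λ c → Fin.any? λ i → copy c i Fin.≟ x)
      where
      trCopy? : ∀ f → Dec (TrCopy G r f)
      trCopy? f =
        map′ (λ h {i} {j} → h i j) (λ h i j → h)
          (Fin.all? λ i → Fin.all? λ j → (f i Fin.≟ f j) →-dec (i Fin.≟ j)) ×-dec
        Fin.all? λ i → Fin.all? λ j → (i Fin.<? j) →-dec (adj G (f i) (f j) Bool.≟ true)

    isPacking-resp-copy : ∀ {k copy copy′ U} → (∀ c i → copy c i ≡ copy′ c i) → IsPacking k copy U → IsPacking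
        k copy′ U
    isPacking-resp-copy {copy′ = copy′} eq (tr , dis , few , cov) =
      (λ c → (λ e → proj₁ (tr c) (trans (eq c _) (trans e (sym (eq c _))))) ,
             (λ i j i<j → subst₂ (λ u v → adj G u v ≡ true) (eq c i) (eq c j) (proj₂ (tr c) i j i<j))) ,
      (λ c c′ i i′ e → dis c c′ i i′ (trans (eq c i) (trans e (sym (eq c′ i′))))) ,
      few ,
      λ x Ux → let c , i , e = cov x Ux in c , i , trans (sym (eq c i)) e

    isPacking-resp-U : ∀ {k copy U U′} → (∀ x → U x ≡ U′ x) → IsPacking k copy U → IsPacking k copy U′
    isPacking-resp-U eq (tr , dis , few , cov) =
      tr , dis , subst (_≤ ℓ) (count-cong eq) few , λ x Ux → cov x (trans (eq x) Ux)

    -- The first vertices of the copies are distinct. The bound makes the search over the number of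
    -- copies finite.
    size≤n : 0 ℕ.< r → (P : TrPacking G r) → k P ≤ n
    size≤n 0<r P = Fin.injective⇒≤ {f = λ c → copy P c (fromℕ< 0<r)} λ {c} {c′} e → disjoint P c c′ _ _ e

    packing? : 0 ℕ.< r → Dec (Σ (TrPacking G r) λ P → CoversAllBut P ℓ)
    packing? 0<r = map′
      (λ (m , copy , U , tr , dis , few , cov) → record
          { k = toℕ m ; copy = copy ; isCopy = tr ; disjoint = dis } , U , few , cov)
      (λ (P , U , few , cov) → encode (k P) (size≤n 0<r P) (copy P , U , isCopy P , disjoint P , few , cov))
      (Fin.any? {suc n} λ m → search-→ (λ _ → refl) (search-→ refl search-Fin)
        {P = λ copy → ∃ λ U → IsPacking (toℕ m) copy U}
        (λ eq (U , p) → U , isPacking-resp-copy eq p)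
        (λ copy → search-→ refl search-Bool {P = λ U → IsPacking (toℕ m) copy U} isPacking-resp-U
            (isPacking? (toℕ m) copy)))
      where
      encode : ∀ m → m ≤ n → (∃ λ copy → ∃ λ U → IsPacking m copy U) → ∃ λ (i : Fin (suc n)) → ∃ λ copy → ∃ λ
          U → IsPacking (toℕ i) copy U
      encode m m≤n = subst (λ m → (∃ λ copy → ∃ λ U → IsPacking m copy U) → _) (Fin.toℕ-fromℕ< (s≤s m≤n))
          (fromℕ< (s≤s m≤n) ,_)

open Combinatorics

open import Data.Rational using (ℚ; 0ℚ; 1ℚ; _<_; _-_; _*_)

-- Rational bounds

fromℚᵘ-homo-+ : ∀ p q → fromℚᵘ (p ℚᵘ.+ q) ≡ fromℚᵘ p ℚ.+ fromℚᵘ q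
fromℚᵘ-homo-+ p q = ℚ.toℚᵘ-injective (begin
  toℚᵘ (fromℚᵘ (p ℚᵘ.+ q))                  ≈⟨ ℚ.toℚᵘ-fromℚᵘ (p ℚᵘ.+ q) ⟩
  p ℚᵘ.+ q                                   ≈⟨ ℚᵘ.+-cong (ℚ.toℚᵘ-fromℚᵘ p) (ℚ.toℚᵘ-fromℚᵘ q) ⟨
  toℚᵘ (fromℚᵘ p) ℚᵘ.+ toℚᵘ (fromℚᵘ q)      ≈⟨ ℚ.toℚᵘ-homo-+ (fromℚᵘ p) (fromℚᵘ q) ⟨
  toℚᵘ (fromℚᵘ p ℚ.+ fromℚᵘ q)              ∎)
  where open import Relation.Binary.Reasoning.Setoid ℚᵘ.≃-setoid

fromℚᵘ-homo-* : ∀ p q → fromℚᵘ (p ℚᵘ.* q) ≡ fromℚᵘ p * fromℚᵘ q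
fromℚᵘ-homo-* p q = ℚ.toℚᵘ-injective (begin
  toℚᵘ (fromℚᵘ (p ℚᵘ.* q))                  ≈⟨ ℚ.toℚᵘ-fromℚᵘ (p ℚᵘ.* q) ⟩
  p ℚᵘ.* q                                   ≈⟨ ℚᵘ.*-cong (ℚ.toℚᵘ-fromℚᵘ p) (ℚ.toℚᵘ-fromℚᵘ q) ⟨
  toℚᵘ (fromℚᵘ p) ℚᵘ.* toℚᵘ (fromℚᵘ q)      ≈⟨ ℚ.toℚᵘ-homo-* (fromℚᵘ p) (fromℚᵘ q) ⟨
  toℚᵘ (fromℚᵘ p * fromℚᵘ q)                ∎)
  where open import Relation.Binary.Reasoning.Setoid ℚᵘ.≃-setoid

fromℚᵘ-mono-≤ : ∀ {p q} → p ℚᵘ.≤ q → fromℚᵘ p ℚ.≤ fromℚᵘ q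
fromℚᵘ-mono-≤ {p} {q} p≤q = ℚ.toℚᵘ-cancel-≤
  (ℚᵘ.≤-respˡ-≃ (ℚᵘ.≃-sym (ℚ.toℚᵘ-fromℚᵘ p)) (ℚᵘ.≤-respʳ-≃ (ℚᵘ.≃-sym (ℚ.toℚᵘ-fromℚᵘ q)) p≤q))

fromℚᵘ-cancel-≤ : ∀ {p q} → fromℚᵘ p ℚ.≤ fromℚᵘ q → p ℚᵘ.≤ q
fromℚᵘ-cancel-≤ {p} {q} p≤q =
  ℚᵘ.≤-respˡ-≃ (ℚ.toℚᵘ-fromℚᵘ p) (ℚᵘ.≤-respʳ-≃ (ℚ.toℚᵘ-fromℚᵘ q) (ℚ.toℚᵘ-mono-≤ p≤q))

ℕtoℚ-+ : ∀ a b → ℕtoℚ (a + b) ≡ ℕtoℚ a ℚ.+ ℕtoℚ b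
ℕtoℚ-+ a b = trans (ℚ.fromℚᵘ-cong {mkℚᵘ (ℤ.+ (a + b)) 0} {mkℚᵘ (ℤ.+ a) 0 ℚᵘ.+ mkℚᵘ (ℤ.+ b) 0}
    (*≡* (cong (ℤ._* ℤ.+ 1) (cong₂ ℤ._+_ (sym (ℤ.*-identityʳ (ℤ.+ a))) (sym (ℤ.*-identityʳ (ℤ.+ b)))))))
  (fromℚᵘ-homo-+ (mkℚᵘ (ℤ.+ a) 0) (mkℚᵘ (ℤ.+ b) 0))

ℕtoℚ-* : ∀ a b → ℕtoℚ (a ℕ.* b) ≡ ℕtoℚ a * ℕtoℚ b
ℕtoℚ-* a b = trans (ℚ.fromℚᵘ-cong {mkℚᵘ (ℤ.+ (a ℕ.* b)) 0} {mkℚᵘ (ℤ.+ a) 0 ℚᵘ.* mkℚᵘ (ℤ.+ b) 0}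
    (*≡* (cong (ℤ._* ℤ.+ 1) (ℤ.pos-* a b))))
  (fromℚᵘ-homo-* (mkℚᵘ (ℤ.+ a) 0) (mkℚᵘ (ℤ.+ b) 0))

ℕtoℚ-mono-≤ : ∀ {a b} → a ≤ b → ℕtoℚ a ℚ.≤ ℕtoℚ b
ℕtoℚ-mono-≤ {a} {b} a≤b = fromℚᵘ-mono-≤ {mkℚᵘ (ℤ.+ a) 0} {mkℚᵘ (ℤ.+ b) 0}
    (*≤* (ℤ.*-monoʳ-≤-nonNeg (ℤ.+ 1) (ℤ.+≤+ a≤b)))

ℕtoℚ-cancel-≤ : ∀ {a b} → ℕtoℚ a ℚ.≤ ℕtoℚ b → a ≤ b
ℕtoℚ-cancel-≤ {a} {b} h with *≤* le ← fromℚᵘ-cancel-≤ {mkℚᵘ (ℤ.+ a) 0} {mkℚᵘ (ℤ.+ b) 0} h =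
  ℤ.drop‿+≤+ (ℤ.*-cancelʳ-≤-pos (ℤ.+ a) (ℤ.+ b) (ℤ.+ 1) le)

ℕtoℚ-nonNeg : ∀ a → ℚ.NonNegative (ℕtoℚ a)
ℕtoℚ-nonNeg a = ℚ.nonNegative (ℕtoℚ-mono-≤ {0} {a} z≤n)

ℕtoℚ-pos : ∀ a → 0 ℕ.< a → ℚ.Positive (ℕtoℚ a)
ℕtoℚ-pos (suc a) _ = ℚ.normalize-pos (suc a) 1

inv-pos : ∀ q → 0 ℕ.< q → 0ℚ < inv q
inv-pos (suc q) _ = ℚ.positive⁻¹ (inv (suc q)) {{ℚ.normalize-pos 1 (suc q)}}

ℕtoℚ*inv : ∀ q → 0 ℕ.< q → ℕtoℚ q * inv q ≡ 1ℚ
ℕtoℚ*inv (suc q) _ = trans (sym (fromℚᵘ-homo-* (mkℚᵘ (ℤ.+ suc q) 0) (mkℚᵘ (ℤ.+ 1) q)))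
  (ℚ.fromℚᵘ-cong {mkℚᵘ (ℤ.+ suc q) 0 ℚᵘ.* mkℚᵘ (ℤ.+ 1) q} {mkℚᵘ (ℤ.+ 1) 0}
      (*≡* (solve 1 (λ x → x :* con (ℤ.+ 1) :* con (ℤ.+ 1) := con (ℤ.+ 1) :* (con (ℤ.+ 1) :* x)) refl (ℤ.+ suc q))))
  where open ℤ.+-*-Solver

-- The denominator of γ will do: multiplied by it, γ becomes its numerator, a positive integer.
archimedean : ∀ γ → 0ℚ < γ → ∃ λ d → 0 ℕ.< d × 1ℚ ℚ.≤ γ * ℕtoℚ d
archimedean γ@(mkℚ +[1+ m ] d-1 _) _ = suc d-1 , s≤s z≤n , subst (1ℚ ℚ.≤_)
  (trans (fromℚᵘ-homo-* (toℚᵘ γ) (mkℚᵘ (ℤ.+ suc d-1) 0)) (cong (_* ℕtoℚ (suc d-1)) (ℚ.fromℚᵘ-toℚᵘ γ)))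
  (fromℚᵘ-mono-≤ {mkℚᵘ (ℤ.+ 1) 0} {toℚᵘ γ ℚᵘ.* mkℚᵘ (ℤ.+ suc d-1) 0} (*≤* (ℤ.+≤+ (bound d-1 m))))
  where
  bound : ∀ d m → 1 ℕ.* (suc d ℕ.* 1) ≤ (suc m ℕ.* suc d) ℕ.* 1
  bound d m = subst₂ _≤_ (sym (trans (*-identityˡ (suc d ℕ.* 1)) (*-identityʳ (suc d))))
      (sym (*-identityʳ (suc m ℕ.* suc d))) (m≤m+n (suc d) (m ℕ.* suc d))
archimedean (mkℚ +0       _ _) (ℚ.*<* (ℤ.+<+ ()))
archimedean (mkℚ -[1+ _ ] _ _) (ℚ.*<* ())

-- The reason is m ≤ (1/r + ε) n ≤ (1/r + 1/q) n, multiplied by q r to return to natural numbers.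
non-neighbours : ∀ {r q n d m ε} → 0 ℕ.< r → 0 ℕ.< q → ε ℚ.≤ inv q → m + d ≡ n →
                 (1ℚ - inv r - ε) * ℕtoℚ n ℚ.≤ ℕtoℚ d → q ℕ.* r ℕ.* m ≤ (q + r) ℕ.* n
non-neighbours {r} {q} {n} {d} {m} {ε} 0<r 0<q ε≤ m+d≡n deg = ℕtoℚ-cancel-≤ (begin
  ℕtoℚ (q ℕ.* r ℕ.* m)                                 ≡⟨ trans (ℕtoℚ-* (q ℕ.* r) m) (cong (_* M) (ℕtoℚ-* q r)) ⟩
  Q * R * M                                              ≤⟨ ℚ.*-monoˡ-≤-nonNeg (Q * R) {{QR≥0}} M≤ ⟩
  Q * R * ((inv r ℚ.+ inv q) * N)
    ≡⟨ solve 5 (λ Q R i j N → Q :* R :* ((i :+ j) :* N) := (Q :* (R :* i) :+ R :* (Q :* j)) :* N) refl Q R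
        (inv r) (inv q) N ⟩
  (Q * (R * inv r) ℚ.+ R * (Q * inv q)) * N
    ≡⟨ cong₂ (λ a b → (Q * a ℚ.+ R * b) * N) (ℕtoℚ*inv r 0<r) (ℕtoℚ*inv q 0<q) ⟩
  (Q * 1ℚ ℚ.+ R * 1ℚ) * N
    ≡⟨ cong₂ (λ a b → (a ℚ.+ b) * N) (ℚ.*-identityʳ Q) (ℚ.*-identityʳ R) ⟩
  (Q ℚ.+ R) * N                                          ≡⟨ trans (ℕtoℚ-* (q + r) n) (cong (_* N) (ℕtoℚ-+ q r)) ⟨
  ℕtoℚ ((q + r) ℕ.* n)                                  ∎)
  where
  open ℚ.≤-Reasoning
  open ℚ.+-*-Solver
  Q R M N D x : ℚ
  Q = ℕtoℚ q
  R = ℕtoℚ r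
  M = ℕtoℚ m
  N = ℕtoℚ n
  D = ℕtoℚ d
  x = (1ℚ - inv r - ε) * N
  QR≥0 : ℚ.NonNegative (Q * R)
  QR≥0 = subst ℚ.NonNegative (ℕtoℚ-* q r) (ℕtoℚ-nonNeg (q ℕ.* r))
  M≤ : M ℚ.≤ (inv r ℚ.+ inv q) * N
  M≤ = begin
    M                             ≡⟨ solve 2 (λ M x → M := (M :+ x) :- x) refl M x ⟩
    (M ℚ.+ x) - x                 ≤⟨ ℚ.+-monoˡ-≤ (ℚ.- x) (ℚ.+-monoʳ-≤ M deg) ⟩
    (M ℚ.+ D) - x                 ≡⟨ cong (_- x) (trans (sym (ℕtoℚ-+ m d)) (cong ℕtoℚ m+d≡n)) ⟩
    N - x
      ≡⟨ solve 3 (λ N i e → N :- (con 1ℚ :- i :- e) :* N := (i :+ e) :* N) refl N (inv r) ε ⟩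
    (inv r ℚ.+ ε) * N             ≤⟨ ℚ.*-monoʳ-≤-nonNeg N {{ℕtoℚ-nonNeg n}} (ℚ.+-monoʳ-≤ (inv r) ε≤) ⟩
    (inv r ℚ.+ inv q) * N         ∎

degree-complement : ∀ {n} (f : Fin n → Bool) → sumFin (λ v → boolToℕ (not (f v))) + count f ≡ n
degree-complement {n} f = trans (sym (sumFin-+ (λ v → boolToℕ (not (f v))) (λ v → boolToℕ (f v))))
  (trans (sumFin-cong λ v → one (f v)) (trans (sumFin-const n 1) (*-identityʳ n)))
  where
  one : ∀ b → boolToℕ (not b) + boolToℕ b ≡ 1
  one true  = refl
  one false = refl

large : ∀ {r n c} → 0 ℕ.< r → n ≤ r ℕ.* c → ℕtoℚ n * inv r ℚ.≤ ℕtoℚ c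
large {r} {n} {c} 0<r n≤ = begin
  ℕtoℚ n * inv r
    ≤⟨ ℚ.*-monoʳ-≤-nonNeg (inv r) {{ℚ.nonNegative (ℚ.<⇒≤ (inv-pos r 0<r))}} (ℕtoℚ-mono-≤ n≤) ⟩
  ℕtoℚ (r ℕ.* c) * inv r        ≡⟨ cong (_* inv r) (ℕtoℚ-* r c) ⟩
  ℕtoℚ r * ℕtoℚ c * inv r       ≡⟨ solve 3 (λ R C i → R :* C :* i := (R :* i) :* C) refl (ℕtoℚ r) (ℕtoℚ c) (inv r) ⟩
  ℕtoℚ r * inv r * ℕtoℚ c       ≡⟨ cong (_* ℕtoℚ c) (ℕtoℚ*inv r 0<r) ⟩
  1ℚ * ℕtoℚ c                   ≡⟨ ℚ.*-identityˡ _ ⟩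
  ℕtoℚ c                        ∎
  where
  open ℚ.≤-Reasoning
  open ℚ.+-*-Solver

-- Cancelling K leaves e ≤ m/d, and 1/d ≤ γ.
sparse : ∀ {γ d K e m} → 0 ℕ.< K ℕ.* d → 1ℚ ℚ.≤ γ * ℕtoℚ d → K ℕ.* d ℕ.* e ≤ K ℕ.* m → ℕtoℚ e ℚ.≤ γ * ℕtoℚ m
sparse {γ} {d} {K} {e} {m} 0<q 1≤γd h = ℚ.*-cancelˡ-≤-pos (ℕtoℚ (K ℕ.* d)) {{ℕtoℚ-pos (K ℕ.* d) 0<q}} (begin
  ℕtoℚ (K ℕ.* d) * ℕtoℚ e               ≡⟨ ℕtoℚ-* (K ℕ.* d) e ⟨
  ℕtoℚ (K ℕ.* d ℕ.* e)                  ≤⟨ ℕtoℚ-mono-≤ h ⟩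
  ℕtoℚ (K ℕ.* m)                        ≡⟨ ℚ.*-identityˡ _ ⟨
  1ℚ * ℕtoℚ (K ℕ.* m)                   ≤⟨ ℚ.*-monoʳ-≤-nonNeg (ℕtoℚ (K ℕ.* m)) {{ℕtoℚ-nonNeg (K ℕ.* m)}} 1≤γd ⟩
  γ * ℕtoℚ d * ℕtoℚ (K ℕ.* m)           ≡⟨ cong (γ * ℕtoℚ d *_) (ℕtoℚ-* K m) ⟩
  γ * ℕtoℚ d * (ℕtoℚ K * ℕtoℚ m)
    ≡⟨ solve 4 (λ g d K m → g :* d :* (K :* m) := K :* d :* (g :* m)) refl γ (ℕtoℚ d) (ℕtoℚ K) (ℕtoℚ m) ⟩
  ℕtoℚ K * ℕtoℚ d * (γ * ℕtoℚ m)        ≡⟨ cong (_* (γ * ℕtoℚ m)) (ℕtoℚ-* K d) ⟨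
  ℕtoℚ (K ℕ.* d) * (γ * ℕtoℚ m)         ∎)
  where
  open ℚ.≤-Reasoning
  open ℚ.+-*-Solver

-- The factor of n² in the bound on q times the number of edges in S: (r + 1)r · r stems from the
-- main term of `Sparse`, the additional 1 from the error term, which is at most n.
edge-const : ℕ → ℕ
edge-const r = 2 ℕ.* suc (suc r ℕ.* r ℕ.* r)

absorb-error : ∀ r {n c} → c ≤ n → 2 ℕ.* (n ℕ.* (suc r ℕ.* r ℕ.* (r ℕ.* n) + c)) ≤ edge-const r ℕ.* (n ℕ.* n)
absorb-error r {n} {c} c≤n = begin
  2 ℕ.* (n ℕ.* (suc r ℕ.* r ℕ.* (r ℕ.* n) + c))
    ≤⟨ *-monoʳ-≤ 2 (*-monoʳ-≤ n (+-monoʳ-≤ (suc r ℕ.* r ℕ.* (r ℕ.* n)) c≤n)) ⟩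
  2 ℕ.* (n ℕ.* (suc r ℕ.* r ℕ.* (r ℕ.* n) + n))
    ≡⟨ solve 3 (λ k r n → con 2 :* (n :* (k :* (r :* n) :+ n)) := con 2 :* (con 1 :+ k :* r) :* (n :* n)) refl
        (suc r ℕ.* r) r n ⟩
  edge-const r ℕ.* (n ℕ.* n)                       ∎
  where
  open ≤-Reasoning
  open +-*-Solver

-- The choice of the constants and the theorem.

module Final {r : ℕ} (0<r : 0 ℕ.< r) {γ ε : ℚ} {d : ℕ} (0<d : 0 ℕ.< d) (1≤γd : 1ℚ ℚ.≤ γ * ℕtoℚ d)
  (ε≤ : ε ℚ.≤ inv (edge-const r ℕ.* d)) {ℓ : ℕ} (L₀≤ℓ : r ℕ.* (r ℕ.* r) ≤ ℓ)
  {n : ℕ} (N₀≤n : edge-const r ℕ.* d ℕ.* error-const r ≤ n) (G : Digraph n) where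

  q : ℕ
  q = edge-const r ℕ.* d

  0<q : 0 ℕ.< q
  0<q = *-mono-≤ {1} {edge-const r} (s≤s z≤n) 0<d

  threshold : ℚ
  threshold = (1ℚ - inv r - ε) * ℕtoℚ n

  Hi⁺ Hi⁻ : Fin n → Set
  Hi⁺ v = threshold ℚ.≤ ℕtoℚ (outdeg G v)
  Hi⁻ v = threshold ℚ.≤ ℕtoℚ (indeg G v)

  Packed SparseLarge : Set
  Packed      = Σ (TrPacking G r) λ P → CoversAllBut P ℓ
  SparseLarge = Σ (VSet n) λ S → γIndependent G γ S × ℕtoℚ n * inv r ℚ.≤ ℕtoℚ (count S)

  sparseLarge? : Dec SparseLarge
  sparseLarge? = search-→ refl search-Bool
    {P = λ S → γIndependent G γ S × ℕtoℚ n * inv r ℚ.≤ ℕtoℚ (count S)}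
    (λ eq (sp , lg) → subst (λ e → ℕtoℚ e ℚ.≤ γ * ℕtoℚ (n ℕ.* n)) (edgesIn-cong G eq) sp ,
                      subst (λ c → ℕtoℚ n * inv r ℚ.≤ ℕtoℚ c) (count-cong eq) lg)
    (λ S → (_ ℚ.≤? _) ×-dec (_ ℚ.≤? _))

  open Signed G Hi⁺ Hi⁻ r using (A; sees)

  few-missed : ∀ a → q ℕ.* r ℕ.* sumFin (λ v → boolToℕ (not (sees a v))) ≤ (q + r) ℕ.* n
  few-missed (u , inj₁ h) = non-neighbours {r} {q} {n} {outdeg G u} {ε = ε} 0<r 0<q ε≤
      (degree-complement (λ v → adj G u v)) h
  few-missed (u , inj₂ h) = non-neighbours {r} {q} {n} {indeg G u} {ε = ε} 0<r 0<q ε≤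
      (degree-complement (λ v → adj G v u)) h

  packed-or-sparse : (∀ v → Hi⁺ v ⊎ Hi⁻ v) → (∀ u v → ¬ Hi⁺ u → ¬ Hi⁻ v → ¬ Edge G u v) → Packed ⊎ SparseLarge
  packed-or-sparse high low-no-edge = decidable-stable (PackingSearch.packing? G r ℓ 0<r ⊎-dec sparseLarge?)
    λ k → D.dichotomy q few-missed (k ∘ convert)
    where
    module D = Dichotomy G Hi⁺ Hi⁻ r 0<r (λ v → _ ℚ.≤? _) (λ v → _ ℚ.≤? _) high low-no-edge
    convert : (Σ (TrPacking G r) λ P → CoversAllBut P (r ℕ.* (r ℕ.* r))) ⊎ ∃ (D.Sparse q) → Packed ⊎ SparseLarge
    convert (inj₁ (P , covers))       = inj₁ (P , coversAllBut-mono {P = P} L₀≤ℓ covers)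
    convert (inj₂ (S , lg , few)) = inj₂ (S ,
      sparse {γ} {d} {edge-const r} 0<q 1≤γd (≤-trans few (absorb-error r N₀≤n)) ,
      large {r} 0<r lg)

theorem5p4 : (r : ℕ) → 3 ≤ r →
    Σ ℚ λ γ₀ → 0ℚ < γ₀ × ((γ : ℚ) → 0ℚ < γ → γ Data.Rational.≤ γ₀ →
    Σ ℚ λ ε₀ → 0ℚ < ε₀ × ((ε : ℚ) → 0ℚ < ε → ε Data.Rational.≤ ε₀ →
    Σ ℕ λ L₀ → (ℓ : ℕ) → L₀ ≤ ℓ →
    Σ ℕ λ N₀ → (n : ℕ) → N₀ ≤ n →
    (G : Digraph n) →
    (∀ x → (1ℚ - inv r - ε) * ℕtoℚ n Data.Rational.≤ ℕtoℚ (outdeg G x)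
    ⊎ (1ℚ - inv r - ε) * ℕtoℚ n Data.Rational.≤ ℕtoℚ (indeg G x)) →
    (∀ x y → ℕtoℚ (outdeg G x) < (1ℚ - inv r - ε) * ℕtoℚ n →
    ℕtoℚ (indeg G y) < (1ℚ - inv r - ε) * ℕtoℚ n →
    adj G x y ≡ true → ⊥) →
    Σ (TrPacking G r) (λ P → CoversAllBut P ℓ)
    ⊎ Σ (VSet n) (λ S → γIndependent G γ S × ℕtoℚ n * inv r Data.Rational.≤ ℕtoℚ (count S))))
theorem5p4 r 3≤r = 1ℚ , inv-pos 1 (s≤s z≤n) , λ γ 0<γ _ →
  let 0<r = ≤-trans (s≤s z≤n) 3≤r
      d , 0<d , 1≤γd = archimedean γ 0<γ
      q = edge-const r ℕ.* d
  -- With ε ≤ 1/q the set S spans at most `edge-const r` · n²/q = n²/d ≤ γ n² edges.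
  in inv q , inv-pos q (*-mono-≤ {1} {edge-const r} (s≤s z≤n) 0<d) , λ ε _ ε≤ →
  -- At most r · r pieces, of fewer than r vertices each, remain outside the packing; and n ≥ q ·
  -- `error-const r` absorbs the error term.
  r ℕ.* (r ℕ.* r) , λ ℓ L₀≤ℓ → q ℕ.* error-const r , λ n N₀≤n G high low-low →
  Final.packed-or-sparse 0<r {γ = γ} {ε = ε} 0<d 1≤γd ε≤ L₀≤ℓ N₀≤n G high
    (λ u v lo-u lo-v → low-low u v (ℚ.≰⇒> lo-u) (ℚ.≰⇒> lo-v))
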